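{- For every fixed integer $m\ge 1$, \[\lim_{n\to\infty}\frac{sat(Q_n,Q_m)}{e(Q_n)}=0.\]
   Context: $Q_n$ is the $n$-dimensional hypercube: vertex set $\{0,1\}^n$, two vertices adjacent iff they differ in exactly one coordinate; $e(Q_n)=n2^{n-1}$ is its number of edges. A copy of a graph $F$ in a graph $G$ is a subgraph of $G$ isomorphic to $F$; $G$ is $F$-free if it contains no copy of $F$. A graph $G$ is $(Q_n,F)$-saturated if $G$ is a subgraph of $Q_n$ (on vertex set $\{0,1\}^n$), $G$ is $F$-free, and adding to $G$ any edge of $E(Q_n)\setminus E(G)$ creates a copy of $F$ (i.e. $G$ is a maximal $F$-free subgraph of $Q_n$). $sat(Q_n,F)$ is the minimum number of edges of a $(Q_n,F)$-saturated graph. -}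

module Defs where

open import Data.Bool.Base using (Bool; true; false)
import Data.Bool.Properties as Bool
open import Data.Fin.Base using (Fin)
import Data.Fin.Properties as Fin
open import Data.Integer.Base using (+_)
open import Data.List.Base using (List; []; _∷_; _++_; map; filter; length)
open import Data.Nat.Base using (ℕ; zero; suc; _≤_; _≥_)
open import Data.Product using (∃-syntax; ∃!; _×_; _,_; uncurry)
open import Data.Rational.Base as ℚ using (ℚ; 0ℚ; ∣_∣; _-_)
open import Data.Sum.Base using (_⊎_; inj₁; inj₂)
open import Data.Vec.Base using (Vec; []; _∷_; lookup)
import Data.Vec.Properties as Vec
open import Function.Base using (_∘_)
open import Function.Definitions using (Injective)
open import Level using (0ℓ)
open import Relation.Binary.Core using (Rel)
open import Relation.Binary.Definitions using (Symmetric; Decidable; DecidableEquality)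
open import Relation.Binary.PropositionalEquality.Core using (_≡_; _≢_; refl; sym)
open import Relation.Nullary.Decidable using (Dec; map′; ¬?; _×-dec_; _⊎-dec_; _→-dec_)
open import Relation.Nullary.Negation.Core using (¬_)

record Graph (V : Set) : Set₁ where
  field
    Adj        : Rel V 0ℓ
    adj?       : Decidable Adj
    adj-sym    : Symmetric Adj
    adj-irrefl : ∀ {v} → ¬ Adj v v

open Graph public

infix 4 _⊆ᴳ_ _⟶_

-- Both graphs share a vertex set, so this is the spanning-subgraph relation.
_⊆ᴳ_ : ∀ {V} → Graph V → Graph V → Set
G ⊆ᴳ H = ∀ {u v} → Adj G u v → Adj H u v

-- A copy of F is given by an isomorphism from F onto a (not necessarily
-- induced) subgraph of G, i.e. an injective homomorphism from F to G.
record Copy {W V : Set} (F : Graph W) (G : Graph V) : Set where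
  field
    to        : W → V
    injective : Injective _≡_ _≡_ to
    preserves : ∀ {x y} → Adj F x y → Adj G (to x) (to y)

Free : ∀ {W V} → Graph W → Graph V → Set
Free F G = ¬ Copy F G

addEdge : ∀ {V} → DecidableEquality V → Graph V → (u v : V) → u ≢ v → Graph V
addEdge _≟_ G u v u≢v = record
  { Adj        = λ x y → Adj G x y ⊎ (x ≡ u × y ≡ v) ⊎ (x ≡ v × y ≡ u)
  ; adj?       = λ x y → adj? G x y ⊎-dec
                         ((x ≟ u ×-dec y ≟ v) ⊎-dec (x ≟ v ×-dec y ≟ u))
  ; adj-sym    = λ { (inj₁ a)                 → inj₁ (adj-sym G a)
                   ; (inj₂ (inj₁ (p , q)))    → inj₂ (inj₂ (q , p))
                   ; (inj₂ (inj₂ (p , q)))    → inj₂ (inj₁ (q , p)) }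
  ; adj-irrefl = λ { (inj₁ a)                       → adj-irrefl G a
                   ; (inj₂ (inj₁ (refl , refl)))    → u≢v refl
                   ; (inj₂ (inj₂ (refl , refl)))    → u≢v refl }
  }

Cube : ℕ → Set
Cube n = Vec Bool n

_≟ᶜ_ : ∀ {n} → DecidableEquality (Cube n)
_≟ᶜ_ = Vec.≡-dec Bool._≟_

Differ : ∀ {n} → Cube n → Cube n → Fin n → Set
Differ u v i = lookup u i ≢ lookup v i

Q : (n : ℕ) → Graph (Cube n)
Q n = record
  { Adj        = λ u v → ∃! _≡_ (Differ u v)
  ; adj?       = λ u v → Fin.any? λ i → differ? u v i ×-dec
                   map′ (λ f {j} → f j) (λ f j → f {j})
                        (Fin.all? λ j → differ? u v j →-dec (i Fin.≟ j))
  ; adj-sym    = λ (i , d , unique) → i , d ∘ sym , λ d′ → unique (d′ ∘ sym)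
  ; adj-irrefl = λ (_ , d , _) → d refl
  }
  where
  differ? : ∀ u v i → Dec (Differ u v i)
  differ? u v i = ¬? (lookup u i Bool.≟ lookup v i)

Q-≢ : ∀ {n} {u v : Cube n} → Adj (Q n) u v → u ≢ v
Q-≢ {n} {u} a refl = adj-irrefl (Q n) {u} a

vertices : (n : ℕ) → List (Cube n)
vertices zero    = [] ∷ []
vertices (suc n) = map (false ∷_) (vertices n) ++ map (true ∷_) (vertices n)

-- For a list without repetitions, each unordered pair of distinct entries
-- occurs exactly once.
pairs : ∀ {A : Set} → List A → List (A × A)
pairs []       = []
pairs (x ∷ xs) = map (x ,_) xs ++ pairs xs

e : ∀ {n} → Graph (Cube n) → ℕ
e {n} G = length (filter (uncurry (adj? G)) (pairs (vertices n)))

record Saturated {W : Set} (n : ℕ) (F : Graph W) (G : Graph (Cube n)) : Set where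
  field
    subgraph : G ⊆ᴳ Q n
    free     : Free F G
    maximal  : ∀ {u v} (uv : Adj (Q n) u v) → ¬ Adj G u v →
               Copy F (addEdge _≟ᶜ_ G u v (Q-≢ uv))

-- s = sat(Q n, F).  A relation, since the minimum is only defined when a
-- saturated graph exists; it is then unique.
record IsSat {W : Set} (n : ℕ) (F : Graph W) (s : ℕ) : Set₁ where
  field
    attained : ∃[ G ] (Saturated n F G × e G ≡ s)
    minimum  : ∀ G → Saturated n F G → s ≤ e G

-- Totalised with value 0 when the denominator is 0.
ratio : ℕ → ℕ → ℚ
ratio p zero      = 0ℚ
ratio p q@(suc _) = + p ℚ./ q

-- Rational ε suffice, as every positive real exceeds a positive rational.
_⟶_ : (ℕ → ℚ) → ℚ → Set
a ⟶ L = ∀ ε → 0ℚ ℚ.< ε → ∃[ N ] (∀ n → n ≥ N → ∣ a n - L ∣ ℚ.< ε)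

-- Write m = k + 1.  The coordinates of Q n are split into 2k small blocks,
-- indexed by (j , t) with j a type in Bool and t in Fin k, and a large rest of
-- free coordinates.  In each block sits a Hamming code: a sparse set of vertices
-- such that every vertex outside is corrected into it by exactly one direction of
-- the block.  Let D j be the union of the k codes of type j.  The graph H has, at
-- the vertices of D j outside the other D, the free edges of type j (the parity of
-- the free coordinates of the lower endpoint), and all the correcting edges of the
-- blocks of type j outside the other D.
--
-- H has no Q m: a copy uses at most one free direction, as any two span a square
-- with edges of both types, and at most one direction per block and only blocks of
-- one type; with a free direction some vertex of the copy would be in no code.
-- But at a vertex in no code, a missing free edge of type j closes a Q m spanned by
-- it and the k corrections of the blocks (j , t).  So a saturated graph containing
-- H has, besides the few edges in block directions, only edges at codewords.

module Submission where

open import Data.Bool.Base using (Bool; true; false; not; _xor_; if_then_else_)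
open import Data.Bool.Properties as Bool
  using (not-¬; ¬-not; not-involutive; xor-assoc; xor-comm; xor-same)
open import Data.Empty using (⊥)
open import Data.Fin.Base using (Fin; zero; suc; _↑ˡ_; _↑ʳ_; splitAt)
import Data.Fin.Properties as Fin
open import Data.Integer.Base as ℤ using (+<+; +[1+_])
import Data.Integer.Properties as ℤ
open import Data.List.Base using (List; []; _∷_; allFin; map; length; _++_; filter; cartesianProduct)
open import Data.List.Membership.Propositional using (_∈_)
open import Data.List.Membership.Propositional.Properties
  using (∈-allFin; ∈-++⁺ˡ; ∈-++⁺ʳ; ∈-map⁺; ∈-cartesianProduct⁺)
open import Data.List.Properties
  using (map-++; map-∘; map-cong; map-tabulate; length-++; length-map; length-tabulate)
open import Data.List.Relation.Unary.All as All using (All; []; _∷_)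
open import Data.List.Relation.Unary.Any using (here; there)
open import Data.Maybe.Base using (Maybe; just; nothing; is-nothing)
open import Data.Maybe.Properties using (just-injective)
open import Data.Nat.Base hiding (parity)
open import Data.Nat.ListAction using (sum)
open import Data.Nat.ListAction.Properties using (sum-++)
open import Data.Nat.Properties
open import Data.Nat.Tactic.RingSolver using (solve-∀)
open import Data.Product using (∃-syntax; Σ-syntax; _×_; _,_; proj₁; proj₂; uncurry)
open import Data.Product.Function.NonDependent.Propositional using (_×-↔_)
open import Data.Product.Properties using (,-injectiveˡ; ,-injectiveʳ; ≡-dec)
open import Data.Rational.Base as ℚ using (ℚ; mkℚ; 0ℚ; ↧ₙ_)
import Data.Rational.Properties as ℚ
import Data.Rational.Unnormalised.Base as ℚᵘ
import Data.Rational.Unnormalised.Properties as ℚᵘ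
open import Data.Sum.Base as Sum using (_⊎_; inj₁; inj₂; [_,_]′)
open import Data.Vec.Base using ([]; _∷_; lookup; tabulate; updateAt; replicate; zipWith)
open import Data.Vec.Properties
  using (lookup∘updateAt; lookup∘updateAt′; updateAt-commutes; updateAt-updateAt-local;
         updateAt-id; tabulate∘lookup; tabulate-cong; ∷-injectiveˡ; ∷-injectiveʳ;
         lookup-replicate; lookup-zipWith; zipWith-assoc; zipWith-comm; zipWith-identityˡ)
open import Function.Base using (_∘_; id; const)
open import Function.Bundles using (_↔_; Inverse; mk↔ₛ′)
open import Function.Definitions using (Injective)
open import Function.Properties.Inverse using (↔-refl; ↔-trans)
open import Relation.Binary.Definitions using (Symmetric) renaming (Decidable to Decidable₂)
open import Relation.Binary.PropositionalEquality
open import Relation.Nullary using (¬_; Dec; yes; no; does; contradiction)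
open import Relation.Nullary.Decidable
  using (map′; ¬?; _×-dec_; _⊎-dec_; _→-dec_; decidable-stable)
open import Relation.Unary using (Decidable)
open import Defs

private variable
  m n : ℕ
  A B : Set

-- Flips of single coordinates.

lookup-ext : (u v : Cube n) → (∀ i → lookup u i ≡ lookup v i) → u ≡ v
lookup-ext u v p = trans (sym (tabulate∘lookup u)) (trans (tabulate-cong p) (tabulate∘lookup v))

toggle : Fin n → Cube n → Cube n
toggle i u = updateAt u i not

toggle-involutive : ∀ i (u : Cube n) → toggle i (toggle i u) ≡ u
toggle-involutive i u =
  trans (updateAt-updateAt-local i u (not-involutive (lookup u i))) (updateAt-id i u)

toggle-comm : ∀ i j (u : Cube n) → toggle i (toggle j u) ≡ toggle j (toggle i u)
toggle-comm i j u with i Fin.≟ j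
... | yes refl = refl
... | no i≢j   = updateAt-commutes i j i≢j u

lookup-toggle : ∀ i (u : Cube n) → lookup (toggle i u) i ≡ not (lookup u i)
lookup-toggle i u = lookup∘updateAt i u

lookup-toggle-≢ : ∀ {i j} (u : Cube n) → i ≢ j → lookup (toggle j u) i ≡ lookup u i
lookup-toggle-≢ {i = i} {j} u i≢j = lookup∘updateAt′ i j i≢j u

toggle-adj : ∀ i (u : Cube n) → Adj (Q n) u (toggle i u)
toggle-adj i u =
  i , (λ eq → not-¬ eq (sym (trans (cong not (lookup-toggle i u)) (not-involutive _)))) , unique
  where
  unique : ∀ {j} → Differ u (toggle i u) j → i ≡ j
  unique {j} d with j Fin.≟ i
  ... | yes j≡i = sym j≡i
  ... | no  j≢i = contradiction (sym (lookup-toggle-≢ u j≢i)) d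

adj⇒toggle : ∀ (u v : Cube n) → Adj (Q n) u v → ∃[ i ] v ≡ toggle i u
adj⇒toggle u v (i , d , unique) = i , lookup-ext v (toggle i u) same
  where
  same : ∀ j → lookup v j ≡ lookup (toggle i u) j
  same j with j Fin.≟ i
  ... | yes refl = trans (¬-not (d ∘ sym)) (sym (lookup-toggle i u))
  ... | no  j≢i  with lookup u j Bool.≟ lookup v j
  ...   | yes eq = trans (sym eq) (sym (lookup-toggle-≢ u j≢i))
  ...   | no  ne = contradiction (sym (unique ne)) j≢i

toggle-injective : ∀ {i j} (u : Cube n) → toggle i u ≡ toggle j u → i ≡ j
toggle-injective {i = i} {j} u eq with i Fin.≟ j
... | yes p  = p
... | no i≢j = contradiction
  (trans (sym (lookup-toggle-≢ u i≢j)) (trans (cong (λ x → lookup x i) (sym eq)) (lookup-toggle i u)))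
  (not-¬ refl)

-- Any two vertices are joined by a path of flips; the leading bit is adjusted first, then the tail.
invariant⇒constant : (P : Cube m → A) → (∀ x c → P (toggle c x) ≡ P x) → ∀ x y → P x ≡ P y
invariant⇒constant P inv []      []      = refl
invariant⇒constant P inv (a ∷ x) (b ∷ y) =
  trans (head a b) (invariant⇒constant (P ∘ (b ∷_)) (λ z c → inv (b ∷ z) (suc c)) x y)
  where
  head : ∀ a b → P (a ∷ x) ≡ P (b ∷ x)
  head false false = refl
  head true  true  = refl
  head true  false = inv (false ∷ x) zero
  head false true  = inv (true ∷ x) zero

-- Subcubes spanned by given directions.

toggleIf : Bool → Fin n → Cube n → Cube n
toggleIf b i u = if b then toggle i u else u

toggleIf-comm : ∀ a b i j (u : Cube n) → toggleIf a i (toggleIf b j u) ≡ toggleIf b j (toggleIf a i u)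
toggleIf-comm false b     i j u = refl
toggleIf-comm true  false i j u = refl
toggleIf-comm true  true  i j u = toggle-comm i j u

toggle-toggleIf : ∀ a i j (u : Cube n) → toggle i (toggleIf a j u) ≡ toggleIf a j (toggle i u)
toggle-toggleIf a i j u = toggleIf-comm true a i j u

-- The subcube through u whose c-th direction is the coordinate dir c.
embed : (Fin m → Fin n) → Cube n → Cube m → Cube n
embed dir u []      = u
embed dir u (b ∷ y) = embed (dir ∘ suc) (toggleIf b (dir zero) u) y

embed-toggle : ∀ (dir : Fin m → Fin n) c u y →
               embed dir u (toggle c y) ≡ toggle (dir c) (embed dir u y)
embed-toggle-base : ∀ (dir : Fin m → Fin n) i u y → embed dir (toggle i u) y ≡ toggle i (embed dir u y)
embed-toggle-base dir i u []      = refl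
embed-toggle-base dir i u (b ∷ y) =
  trans (cong (λ x → embed (dir ∘ suc) x y) (sym (toggle-toggleIf b i (dir zero) u)))
        (embed-toggle-base (dir ∘ suc) i _ y)
embed-toggle dir zero    u (false ∷ y) = embed-toggle-base (dir ∘ suc) (dir zero) u y
embed-toggle dir zero    u (true ∷ y)  =
  trans (cong (λ x → embed (dir ∘ suc) x y) (sym (toggle-involutive (dir zero) u)))
        (embed-toggle-base (dir ∘ suc) (dir zero) _ y)
embed-toggle dir (suc c) u (b ∷ y) = embed-toggle (dir ∘ suc) c _ y

embed-origin : ∀ (dir : Fin m → Fin n) u → embed dir u (replicate m false) ≡ u
embed-origin {m = zero}  dir u = refl
embed-origin {m = suc m} dir u = embed-origin (dir ∘ suc) u

-- Every vertex of the subcube is compared with the image of the origin, which is `u`.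
embed-invariant : ∀ (g : Cube n → A) (dir : Fin m → Fin n) →
                  (∀ c u → g (toggle (dir c) u) ≡ g u) → ∀ u y → g (embed dir u y) ≡ g u
embed-invariant g dir inv u y =
  trans (invariant⇒constant (λ y → g (embed dir u y))
           (λ x c → trans (cong g (embed-toggle dir c u x)) (inv c _)) y (replicate _ false))
        (cong g (embed-origin dir u))

embed-sensitive : ∀ (g : Cube n → A) (dir : Fin m → Fin n) t →
                  (∀ c → c ≢ t → ∀ u → g (toggle (dir c) u) ≡ g u) →
                  ∀ u y → g (embed dir u y) ≡ g (toggleIf (lookup y t) (dir t) u)
embed-sensitive g dir zero    inv u (b ∷ y) =
  embed-invariant g (dir ∘ suc) (λ c → inv (suc c) λ ()) _ y
embed-sensitive g dir (suc t) inv u (b ∷ y) = trans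
  (embed-sensitive g (dir ∘ suc) t (λ c c≢t → inv (suc c) (c≢t ∘ Fin.suc-injective)) _ y)
  (trans (cong g (toggleIf-comm (lookup y t) b (dir (suc t)) (dir zero) u))
         (head b (toggleIf (lookup y t) (dir (suc t)) u)))
  where
  head : ∀ b v → g (toggleIf b (dir zero) v) ≡ g v
  head false v = refl
  head true  v = inv zero (λ ()) v

lookup-toggleIf : ∀ b i (u : Cube n) → lookup (toggleIf b i u) i ≡ b xor lookup u i
lookup-toggleIf false i u = refl
lookup-toggleIf true  i u = lookup-toggle i u

xor-cancelʳ : ∀ a b c → a xor c ≡ b xor c → a ≡ b
xor-cancelʳ false false _     _ = refl
xor-cancelʳ true  true  _     _ = refl
xor-cancelʳ false true  false ()
xor-cancelʳ false true  true  ()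
xor-cancelʳ true  false false ()
xor-cancelʳ true  false true  ()

-- Coordinate `dir c` of the image is bit `c` of the argument up to a constant given by `u`, so each
-- bit can be recovered.
embed-injective : ∀ (dir : Fin m → Fin n) → Injective _≡_ _≡_ dir → ∀ u → Injective _≡_ _≡_ (embed dir u)
embed-injective dir dir-inj u {x} {y} eq = lookup-ext x y λ c →
  xor-cancelʳ _ _ (lookup u (dir c)) (trans (sym (bit x c)) (trans (cong (λ z → lookup z (dir c)) eq) (bit y c)))
  where
  bit : ∀ y c → lookup (embed dir u y) (dir c) ≡ lookup y c xor lookup u (dir c)
  bit y c = trans
    (embed-sensitive (λ z → lookup z (dir c)) dir c
      (λ c′ c′≢c z → lookup-toggle-≢ z (λ p → c′≢c (sym (dir-inj p)))) u y)
    (lookup-toggleIf (lookup y c) (dir c) u)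

-- Directions of the edges in a copy of a cube.

module _ {G : Graph (Cube n)} (G⊆Q : G ⊆ᴳ Q n) (κ : Copy (Q m) G) where
  open Copy κ

  private
    step : ∀ x c → Adj (Q n) (to x) (to (toggle c x))
    step x c = G⊆Q {to x} (preserves {x} (toggle-adj c x))

  direction : Cube m → Fin m → Fin n
  direction x c = proj₁ (adj⇒toggle (to x) (to (toggle c x)) (step x c))

  to-toggle : ∀ x c → to (toggle c x) ≡ toggle (direction x c) (to x)
  to-toggle x c = proj₂ (adj⇒toggle (to x) (to (toggle c x)) (step x c))

  -- Different neighbours of `x` have different images.
  direction-injective : ∀ x → Injective _≡_ _≡_ (direction x)
  direction-injective x {c} {d} eq = toggle-injective x (injective
    (trans (to-toggle x c) (trans (cong (λ i → toggle i (to x)) eq) (sym (to-toggle x d)))))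

  -- Opposite edges of a 4-cycle of the cube have the same direction.
  direction-toggle : ∀ x c d → direction (toggle d x) c ≡ direction x c
  direction-toggle x c d with d Fin.≟ c
  ... | yes refl = toggle-injective (to (toggle c x)) (begin
      toggle (direction (toggle c x) c) (to (toggle c x))   ≡⟨ to-toggle (toggle c x) c ⟨
      to (toggle c (toggle c x))                            ≡⟨ cong to (toggle-involutive c x) ⟩
      to x                                                  ≡⟨ toggle-involutive (direction x c) (to x) ⟨
      toggle (direction x c) (toggle (direction x c) (to x)) ≡⟨ cong (toggle (direction x c)) (to-toggle x c) ⟨
      toggle (direction x c) (to (toggle c x))              ∎)
    where open ≡-Reasoning
  ... | no d≢c   with direction x c Fin.≟ direction (toggle d x) c
  ...   | yes i≡q = sym i≡q
  ...   | no  i≢q = contradiction bits (not-¬ refl)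
    where
    i = direction x c
    p = direction (toggle c x) d
    q = direction (toggle d x) c
    k = direction x d
    square : toggle p (toggle i (to x)) ≡ toggle q (toggle k (to x))
    square = begin
      toggle p (toggle i (to x))  ≡⟨ cong (toggle p) (to-toggle x c) ⟨
      toggle p (to (toggle c x))  ≡⟨ to-toggle (toggle c x) d ⟨
      to (toggle d (toggle c x))  ≡⟨ cong to (toggle-comm d c x) ⟩
      to (toggle c (toggle d x))  ≡⟨ to-toggle (toggle d x) c ⟩
      toggle q (to (toggle d x))  ≡⟨ cong (toggle q) (to-toggle x d) ⟩
      toggle q (toggle k (to x))  ∎
      where open ≡-Reasoning
    i≢k : i ≢ k
    i≢k eq = d≢c (sym (direction-injective x eq))
    i≢p : i ≢ p
    i≢p eq = d≢c (toggle-injective (toggle c x) (injective (begin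
      to (toggle d (toggle c x))  ≡⟨ to-toggle (toggle c x) d ⟩
      toggle p (to (toggle c x))  ≡⟨ cong (toggle p) (to-toggle x c) ⟩
      toggle p (toggle i (to x))  ≡⟨ cong (λ j → toggle j (toggle i (to x))) eq ⟨
      toggle i (toggle i (to x))  ≡⟨ toggle-involutive i (to x) ⟩
      to x                        ≡⟨ cong to (toggle-involutive c x) ⟨
      to (toggle c (toggle c x))  ∎)))
      where open ≡-Reasoning
    -- Going round the square one way never flips coordinate `i`, going the other way flips it
    -- exactly once.
    bits : lookup (to x) i ≡ not (lookup (to x) i)
    bits = begin
      lookup (to x) i                         ≡⟨ lookup-toggle-≢ (to x) i≢k ⟨
      lookup (toggle k (to x)) i              ≡⟨ lookup-toggle-≢ (toggle k (to x)) i≢q ⟨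
      lookup (toggle q (toggle k (to x))) i   ≡⟨ cong (λ v → lookup v i) square ⟨
      lookup (toggle p (toggle i (to x))) i   ≡⟨ lookup-toggle-≢ (toggle i (to x)) i≢p ⟩
      lookup (toggle i (to x)) i              ≡⟨ lookup-toggle i (to x) ⟩
      not (lookup (to x) i) ∎
      where open ≡-Reasoning

-- Double counting

∑ : List A → (A → ℕ) → ℕ
∑ xs f = sum (map f xs)

∑-cong : ∀ {f g : A → ℕ} → f ≗ g → ∀ xs → ∑ xs f ≡ ∑ xs g
∑-cong f≗g xs = cong sum (map-cong f≗g xs)

∑-mono : ∀ {f g : A → ℕ} → (∀ x → f x ≤ g x) → ∀ xs → ∑ xs f ≤ ∑ xs g
∑-mono f≤g []       = z≤n
∑-mono f≤g (x ∷ xs) = +-mono-≤ (f≤g x) (∑-mono f≤g xs)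

∑-+ : ∀ (f g : A → ℕ) xs → ∑ xs (λ x → f x + g x) ≡ ∑ xs f + ∑ xs g
∑-+ f g []       = refl
∑-+ f g (x ∷ xs) rewrite ∑-+ f g xs = lemma (f x) (g x) (∑ xs f) (∑ xs g)
  where
  lemma : ∀ a b c d → a + b + (c + d) ≡ a + c + (b + d)
  lemma = solve-∀

∑-const : ∀ c (xs : List A) → ∑ xs (λ _ → c) ≡ length xs * c
∑-const c []       = refl
∑-const c (x ∷ xs) = cong (c +_) (∑-const c xs)

∑-*ˡ : ∀ c (f : A → ℕ) xs → ∑ xs (λ x → c * f x) ≡ c * ∑ xs f
∑-*ˡ c f []       = sym (*-zeroʳ c)
∑-*ˡ c f (x ∷ xs) = trans (cong (c * f x +_) (∑-*ˡ c f xs)) (sym (*-distribˡ-+ c (f x) (∑ xs f)))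

∑-swap : ∀ (f : A → B → ℕ) xs ys → ∑ xs (λ x → ∑ ys (f x)) ≡ ∑ ys (λ y → ∑ xs (λ x → f x y))
∑-swap f []       ys = sym (trans (∑-const 0 ys) (*-zeroʳ (length ys)))
∑-swap f (x ∷ xs) ys = trans (cong (∑ ys (f x) +_) (∑-swap f xs ys))
  (sym (∑-+ (f x) (λ y → ∑ xs (λ x → f x y)) ys))

∑-++ : ∀ (f : A → ℕ) xs ys → ∑ (xs ++ ys) f ≡ ∑ xs f + ∑ ys f
∑-++ f xs ys = trans (cong sum (map-++ f xs ys)) (sum-++ (map f xs) (map f ys))

∑-map : ∀ (f : B → ℕ) (g : A → B) xs → ∑ (map g xs) f ≡ ∑ xs (f ∘ g)
∑-map f g xs = cong sum (sym (map-∘ xs))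

∑-member : ∀ (f : A → ℕ) {x xs} → x ∈ xs → f x ≤ ∑ xs f
∑-member f (here refl) = m≤m+n _ _
∑-member f (there x∈)  = m≤n⇒m≤o+n _ (∑-member f x∈)

∑-allFin-suc : ∀ (f : Fin (suc n) → ℕ) → ∑ (allFin (suc n)) f ≡ f zero + ∑ (allFin n) (f ∘ suc)
∑-allFin-suc {n} f = cong (λ xs → f zero + sum xs)
  (trans (map-tabulate suc f) (sym (map-tabulate id (f ∘ suc))))

∑-vertices-suc : ∀ (f : Cube (suc n) → ℕ) →
  ∑ (vertices (suc n)) f ≡ ∑ (vertices n) (f ∘ (false ∷_)) + ∑ (vertices n) (f ∘ (true ∷_))
∑-vertices-suc {n} f = trans (∑-++ f (map (false ∷_) (vertices n)) (map (true ∷_) (vertices n)))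
  (cong₂ _+_ (∑-map f (false ∷_) (vertices n)) (∑-map f (true ∷_) (vertices n)))

length-vertices : ∀ n → length (vertices n) ≡ 2 ^ n
length-vertices zero    = refl
length-vertices (suc n) = begin
  length (map (false ∷_) (vertices n) ++ map (true ∷_) (vertices n))
    ≡⟨ length-++ (map (false ∷_) (vertices n)) ⟩
  length (map (false ∷_) (vertices n)) + length (map (true ∷_) (vertices n))
    ≡⟨ cong₂ _+_ (length-map _ (vertices n)) (length-map _ (vertices n)) ⟩
  length (vertices n) + length (vertices n)
    ≡⟨ cong₂ _+_ (length-vertices n) (trans (length-vertices n) (sym (+-identityʳ _))) ⟩
  2 ^ suc n ∎
  where open ≡-Reasoning

∑-vertices-const : ∀ n c → ∑ (vertices n) (λ _ → c) ≡ 2 ^ n * c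
∑-vertices-const n c = trans (∑-const c (vertices n)) (cong (_* c) (length-vertices n))

∑-toggle : ∀ i (f : Cube n → ℕ) → ∑ (vertices n) (f ∘ toggle i) ≡ ∑ (vertices n) f
∑-toggle zero f = trans (∑-vertices-suc (f ∘ toggle zero))
  (trans (+-comm (∑ (vertices _) (f ∘ (true ∷_))) _) (sym (∑-vertices-suc f)))
∑-toggle (suc i) f = trans (∑-vertices-suc (f ∘ toggle (suc i)))
  (trans (cong₂ _+_ (∑-toggle i (f ∘ (false ∷_))) (∑-toggle i (f ∘ (true ∷_)))) (sym (∑-vertices-suc f)))

∑-split : ∀ b (f : Cube (suc n) → ℕ) →
  ∑ (vertices (suc n)) f ≡ ∑ (vertices n) (f ∘ (b ∷_)) + ∑ (vertices n) (f ∘ (not b ∷_))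
∑-split false f = ∑-vertices-suc f
∑-split true  f = trans (∑-vertices-suc f) (+-comm (∑ (vertices _) (f ∘ (false ∷_))) _)

∑-zero : ∀ {f : A → ℕ} → (∀ x → f x ≡ 0) → ∀ xs → ∑ xs f ≡ 0
∑-zero f≡0 xs = trans (∑-cong f≡0 xs) (trans (∑-const 0 xs) (*-zeroʳ (length xs)))

∑-single : ∀ u (f : Cube n → ℕ) → (∀ v → v ≢ u → f v ≡ 0) → ∑ (vertices n) f ≡ f u
∑-single []      f _ = +-identityʳ (f [])
∑-single (b ∷ u) f supp = trans (∑-split b f) (trans
  (cong₂ _+_ (∑-single u (f ∘ (b ∷_)) (λ v v≢u → supp _ (v≢u ∘ ∷-injectiveʳ)))
             (∑-zero {f = f ∘ (not b ∷_)}
               (λ v → supp _ (λ eq → not-¬ refl (sym (∷-injectiveˡ eq)))) (vertices _)))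
  (+-identityʳ _))

-- Split by the leading bit: one half of the cube holds a single neighbour of `b ∷ u`, the other
-- half holds those given by the neighbours of the tail.
∑-neighbours : ∀ u (f : Cube n → ℕ) → (∀ v → (∀ i → v ≢ toggle i u) → f v ≡ 0) →
               ∑ (vertices n) f ≡ ∑ (allFin n) (λ i → f (toggle i u))
∑-neighbours []      f supp = trans (+-identityʳ _) (supp [] λ ())
∑-neighbours (b ∷ u) f supp = begin
  ∑ (vertices _) f
    ≡⟨ ∑-split b f ⟩
  ∑ (vertices _) (f ∘ (b ∷_)) + ∑ (vertices _) (f ∘ (not b ∷_))
    ≡⟨ cong₂ _+_ (∑-neighbours u (f ∘ (b ∷_)) supp-b) (∑-single u (f ∘ (not b ∷_)) supp-¬b) ⟩
  ∑ (allFin _) (λ i → f (b ∷ toggle i u)) + f (not b ∷ u)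
    ≡⟨ +-comm _ (f (not b ∷ u)) ⟩
  f (not b ∷ u) + ∑ (allFin _) (λ i → f (b ∷ toggle i u))
    ≡⟨ ∑-allFin-suc (λ i → f (toggle i (b ∷ u))) ⟨
  ∑ (allFin _) (λ i → f (toggle i (b ∷ u))) ∎
  where
  open ≡-Reasoning
  supp-b : ∀ v → (∀ i → v ≢ toggle i u) → f (b ∷ v) ≡ 0
  supp-b v away = supp (b ∷ v) λ
    { zero    eq → not-¬ refl (∷-injectiveˡ eq)
    ; (suc i) eq → away i (∷-injectiveʳ eq) }
  supp-¬b : ∀ v → v ≢ u → f (not b ∷ v) ≡ 0
  supp-¬b v v≢u = supp (not b ∷ v) λ
    { zero    eq → v≢u (∷-injectiveʳ eq)
    ; (suc i) eq → not-¬ refl (sym (∷-injectiveˡ eq)) }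

ι : Bool → ℕ
ι b = if b then 1 else 0

#_ : ∀ {P : Set} → Dec P → ℕ
# P? = ι (does P?)

#-yes : ∀ {P : Set} (P? : Dec P) → P → # P? ≡ 1
#-yes (yes _) _ = refl
#-yes (no ¬p) p = contradiction p ¬p

#-no : ∀ {P : Set} (P? : Dec P) → ¬ P → # P? ≡ 0
#-no (yes p) ¬p = contradiction p ¬p
#-no (no _)  _  = refl

#-cong : ∀ {P Q : Set} (P? : Dec P) (Q? : Dec Q) → (P → Q) → (Q → P) → # P? ≡ # Q?
#-cong (yes p) Q? f g = sym (#-yes Q? (f p))
#-cong (no ¬p) Q? f g = sym (#-no Q? (¬p ∘ g))

#-bound : ∀ {P : Set} (P? : Dec P) {c} → (P → 1 ≤ c) → # P? ≤ c
#-bound (yes p) f = f p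
#-bound (no _)  _ = z≤n

length-filter : ∀ {P : A → Set} (P? : ∀ x → Dec (P x)) xs → length (filter P? xs) ≡ ∑ xs (λ x → # (P? x))
length-filter P? []       = refl
length-filter P? (x ∷ xs) with does (P? x)
... | false = length-filter P? xs
... | true  = cong suc (length-filter P? xs)

-- A new head adds a row and a column to the adjacency matrix; they agree by symmetry, and the
-- diagonal entry vanishes by irreflexivity.
handshake : ∀ {R : A → A → Set} (R? : Decidable₂ R) → Symmetric R → (∀ {x} → ¬ R x x) → ∀ xs →
  2 * length (filter (uncurry R?) (pairs xs)) ≡ ∑ xs (λ u → ∑ xs (λ v → # (R? u v)))
handshake R? R-sym R-irrefl []       = refl
handshake {R = R} R? R-sym R-irrefl (x ∷ xs) = begin
  2 * length (filter (uncurry R?) (map (x ,_) xs ++ pairs xs))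
    ≡⟨ cong (2 *_) (length-filter (uncurry R?) (map (x ,_) xs ++ pairs xs)) ⟩
  2 * ∑ (map (x ,_) xs ++ pairs xs) (λ p → # (uncurry R? p))
    ≡⟨ cong (2 *_) (∑-++ _ (map (x ,_) xs) (pairs xs)) ⟩
  2 * (∑ (map (x ,_) xs) (λ p → # (uncurry R? p)) + ∑ (pairs xs) (λ p → # (uncurry R? p)))
    ≡⟨ cong₂ (λ a b → 2 * (a + b)) (∑-map _ (x ,_) xs) (sym (length-filter (uncurry R?) (pairs xs))) ⟩
  2 * (row + length (filter (uncurry R?) (pairs xs)))
    ≡⟨ *-distribˡ-+ 2 row _ ⟩
  2 * row + 2 * length (filter (uncurry R?) (pairs xs))
    ≡⟨ cong (2 * row +_) (handshake R? R-sym R-irrefl xs) ⟩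
  2 * row + rest
    ≡⟨ lemma row rest ⟩
  0 + row + (row + rest)
    ≡⟨ cong₂ (λ a b → a + row + (b + rest)) (sym (#-no (R? x x) R-irrefl))
             (∑-cong (λ u → #-cong (R? x u) (R? u x) R-sym R-sym) xs) ⟩
  # (R? x x) + row + (∑ xs (λ u → # (R? u x)) + rest)
    ≡⟨ cong (# (R? x x) + row +_) (sym (∑-+ (λ u → # (R? u x)) (λ u → ∑ xs (λ v → # (R? u v))) xs)) ⟩
  # (R? x x) + row + ∑ xs (λ u → # (R? u x) + ∑ xs (λ v → # (R? u v))) ∎
  where
  open ≡-Reasoning
  row rest : ℕ
  row  = ∑ xs (λ v → # (R? x v))
  rest = ∑ xs (λ u → ∑ xs (λ v → # (R? u v)))
  lemma : ∀ a b → 2 * a + b ≡ 0 + a + (a + b)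
  lemma = solve-∀

-- Adj (Q n) u v unfolds to a type from which u and v cannot be inferred, hence
-- the expanded forms λ {u} {v} → p {u} {v} of inclusions p here and below.
degree-sum : ∀ {G : Graph (Cube n)} → G ⊆ᴳ Q n →
  2 * e G ≡ ∑ (vertices n) (λ u → ∑ (allFin n) (λ i → # (adj? G u (toggle i u))))
degree-sum {n} {G} G⊆Q = trans
  (handshake (adj? G) (λ {x} {y} → adj-sym G {x} {y}) (λ {x} → adj-irrefl G {x}) (vertices n))
  (∑-cong (λ u → ∑-neighbours u (λ v → # (adj? G u v)) (λ v away →
    #-no (adj? G u v) λ a → uncurry away (adj⇒toggle u v (G⊆Q {u} {v} a)))) (vertices n))

2*e-cube : ∀ n → 2 * e (Q n) ≡ 2 ^ n * n
2*e-cube n = begin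
  2 * e (Q n)
    ≡⟨ degree-sum {G = Q n} (λ {u} {v} a → a) ⟩
  ∑ (vertices n) (λ u → ∑ (allFin n) (λ i → # (adj? (Q n) u (toggle i u))))
    ≡⟨ ∑-cong (λ u → ∑-cong (λ i → #-yes (adj? (Q n) u (toggle i u)) (toggle-adj i u))
         (allFin n)) (vertices n) ⟩
  ∑ (vertices n) (λ u → ∑ (allFin n) (λ i → 1))
    ≡⟨ ∑-vertices-const n _ ⟩
  2 ^ n * ∑ (allFin n) (λ i → 1)
    ≡⟨ cong (2 ^ n *_) (trans (∑-const 1 (allFin n)) (trans (*-identityʳ _) (length-tabulate {n = n} id))) ⟩
  2 ^ n * n ∎
  where open ≡-Reasoning

-- An edge at `u` is charged to its direction if that is not free, and otherwise to a code
-- containing `u`. A codeword can be charged for all `n` directions, hence the factor `n`.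
edge-bound : ∀ {G : Graph (Cube n)} → G ⊆ᴳ Q n →
  (free : Fin n → Bool) {B : Set} (z : B → Cube n → Bool) (βs : List B) →
  (∀ u i → Adj G u (toggle i u) → free i ≡ false ⊎ ∃[ β ] β ∈ βs × z β u ≡ true) →
  2 * e G ≤ 2 ^ n * ∑ (allFin n) (λ i → ι (not (free i)))
            + n * ∑ βs (λ β → ∑ (vertices n) (λ u → ι (z β u)))
edge-bound {n} {G} G⊆Q free z βs cover = begin
  2 * e G
    ≡⟨ degree-sum {G = G} (λ {u} {v} → G⊆Q {u} {v}) ⟩
  ∑ (vertices n) (λ u → ∑ (allFin n) (λ i → # (adj? G u (toggle i u))))
    ≤⟨ ∑-mono (λ u → ∑-mono (λ i → #-bound (adj? G u (toggle i u)) (covered u i)) (allFin n)) (vertices n) ⟩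
  ∑ (vertices n) (λ u → ∑ (allFin n) (λ i → ι (not (free i)) + codes u))
    ≡⟨ ∑-cong (λ u → trans (∑-+ (ι ∘ not ∘ free) (λ _ → codes u) (allFin n))
         (cong (∑ (allFin n) (ι ∘ not ∘ free) +_) (trans (∑-const (codes u) (allFin n))
            (cong (_* codes u) (length-tabulate {n = n} id))))) (vertices n) ⟩
  ∑ (vertices n) (λ u → ∑ (allFin n) (ι ∘ not ∘ free) + n * codes u)
    ≡⟨ ∑-+ (λ _ → ∑ (allFin n) (ι ∘ not ∘ free)) (λ u → n * codes u) (vertices n) ⟩
  ∑ (vertices n) (λ _ → ∑ (allFin n) (ι ∘ not ∘ free)) + ∑ (vertices n) (λ u → n * codes u)
    ≡⟨ cong₂ _+_ (∑-vertices-const n _)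
         (trans (∑-*ˡ n codes (vertices n)) (cong (n *_) (∑-swap (λ u β → ι (z β u)) (vertices n) βs))) ⟩
  2 ^ n * ∑ (allFin n) (λ i → ι (not (free i))) + n * ∑ βs (λ β → ∑ (vertices n) (λ u → ι (z β u))) ∎
  where
  open ≤-Reasoning
  codes : Cube n → ℕ
  codes u = ∑ βs (λ β → ι (z β u))
  covered : ∀ u i → Adj G u (toggle i u) → 1 ≤ ι (not (free i)) + codes u
  covered u i a with cover u i a
  ... | inj₁ eq rewrite eq = s≤s z≤n
  ... | inj₂ (β , β∈ , eq) = m≤n⇒m≤o+n (ι (not (free i)))
    (≤-trans (≤-reflexive (sym (cong ι eq))) (∑-member (λ β → ι (z β u)) β∈))

∑-initial : ∀ K {n} (g : Fin (K + n) → ℕ) → (∀ i → g i ≤ 1) → (∀ i → g (K ↑ʳ i) ≡ 0) →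
            ∑ (allFin (K + n)) g ≤ K
∑-initial zero    g _   g≡0 = ≤-reflexive (∑-zero g≡0 (allFin _))
∑-initial (suc K) g g≤1 g≡0 = ≤-trans (≤-reflexive (∑-allFin-suc g))
  (+-mono-≤ (g≤1 zero) (∑-initial K (g ∘ suc) (g≤1 ∘ suc) g≡0))

-- Exhaustive search over finite types.

Searchable : Set → Set₁
Searchable A = ∀ {P : A → Set} → Decidable P → Dec (∃[ x ] P x)

search-all : Searchable A → ∀ {P : A → Set} → Decidable P → Dec (∀ x → P x)
search-all search P? with search (¬? ∘ P?)
... | yes (x , ¬p) = no λ p → ¬p (p x)
... | no none      = yes λ x → decidable-stable (P? x) λ ¬p → none (x , ¬p)

search-Bool : Searchable Bool
search-Bool P? with P? false | P? true
... | yes p | _     = yes (false , p)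
... | no  _ | yes p = yes (true , p)
... | no ¬p | no ¬q = no λ { (false , p) → ¬p p ; (true , p) → ¬q p }

search-× : Searchable A → Searchable B → Searchable (A × B)
search-× searchA searchB P? = map′
  (λ (a , b , p) → (a , b) , p) (λ ((a , b) , p) → a , b , p)
  (searchA λ a → searchB λ b → P? (a , b))

search-Cube : ∀ n → Searchable (Cube n)
search-Cube zero    P? = map′ (λ p → [] , p) (λ { ([] , p) → p }) (P? [])
search-Cube (suc n) P? = map′
  (λ ((b , u) , p) → b ∷ u , p) (λ { (b ∷ u , p) → (b , u) , p })
  (search-× search-Bool (search-Cube n) λ (b , u) → P? (b ∷ u))

-- The sparse graph H

not≢ : ∀ {b} → not b ≢ b
not≢ p = not-¬ refl (sym p)

-- z β u says that u lies in the code of block β.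
record Coding (n k r K : ℕ) : Set where
  field
    free             : Fin n → Bool
    parity           : Cube n → Bool
    z                : Bool × Fin k → Cube n → Bool
    parity-toggle    : ∀ i u → parity (toggle i u) ≡ free i xor parity u
    z-free           : ∀ {i} → free i ≡ true → ∀ β u → z β (toggle i u) ≡ z β u
    z-block          : ∀ {i β γ u v} → z β (toggle i u) ≢ z β u → z γ (toggle i v) ≢ z γ v → β ≡ γ
    corrector        : ∀ β u → z β u ≡ false → ∃[ i ] z β (toggle i u) ≡ true
    corrector-unique : ∀ {β u i j} → z β u ≡ false →
                       z β (toggle i u) ≡ true → z β (toggle j u) ≡ true → i ≡ j
    bound-count      : ∑ (allFin n) (λ i → ι (not (free i))) ≤ K
    code-size        : ∀ β → 2 ^ r * ∑ (vertices n) (λ u → ι (z β u)) ≡ 2 ^ n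

module Construction {n k r K : ℕ} (coding : Coding n k r K) where
  open Coding coding

  D : Bool → Cube n → Set
  D j u = ∃[ t ] z (j , t) u ≡ true

  D? : ∀ j u → Dec (D j u)
  D? j u = Fin.any? λ t → z (j , t) u Bool.≟ true

  -- For a free direction i, the parity of the lower endpoint of the edge.
  type : Fin n → Cube n → Bool
  type i u = parity u xor lookup u i

  -- Conditions on the edge of direction `i` at its endpoint `u`. In `BoundEdge` exactly one
  -- endpoint lies in the code of `(j , t)`, so the edge is a correction of that block.
  FreeEdge BoundEdge Edge : Fin n → Cube n → Set
  FreeEdge  i u = free i ≡ true × D (type i u) u × ¬ D (not (type i u)) u
  BoundEdge i u = ∃[ j ] (∃[ t ] z (j , t) (toggle i u) ≢ z (j , t) u) × ¬ D (not j) u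
  Edge      i u = FreeEdge i u ⊎ BoundEdge i u

  edge? : ∀ i u → Dec (Edge i u)
  edge? i u =
    (free i Bool.≟ true ×-dec D? (type i u) u ×-dec ¬? (D? (not (type i u)) u))
    ⊎-dec search-Bool λ j →
      (Fin.any? λ t → ¬? (z (j , t) (toggle i u) Bool.≟ z (j , t) u)) ×-dec ¬? (D? (not j) u)

  z-other : ∀ {i β γ u} v → z β (toggle i u) ≢ z β u → γ ≢ β → z γ (toggle i v) ≡ z γ v
  z-other v touch γ≢β = decidable-stable (_ Bool.≟ _) λ ne → γ≢β (z-block ne touch)

  -- The parity and coordinate `i` flip together, so both endpoints of a free edge give it the same
  -- type.
  type-self : ∀ i u → free i ≡ true → type i (toggle i u) ≡ type i u
  type-self i u fr rewrite parity-toggle i u | fr | lookup-toggle i u =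
    lemma (parity u) (lookup u i)
    where
    lemma : ∀ a b → not a xor not b ≡ a xor b
    lemma false false = refl
    lemma false true  = refl
    lemma true  b     = refl

  type-bound : ∀ {i j} u → i ≢ j → free j ≡ false → type i (toggle j u) ≡ type i u
  type-bound {i} {j} u i≢j fr rewrite parity-toggle j u | fr | lookup-toggle-≢ u i≢j = refl

  -- Only the parity flips, so two free directions span a square with edges of both types; this
  -- excludes two free directions in a copy.
  type-free : ∀ {i j} u → i ≢ j → free j ≡ true → type i (toggle j u) ≡ not (type i u)
  type-free {i} {j} u i≢j fr rewrite parity-toggle j u | fr | lookup-toggle-≢ u i≢j =
    sym (Bool.not-distribˡ-xor (parity u) (lookup u i))

  bound⇒¬free : ∀ {i β u} → z β (toggle i u) ≢ z β u → free i ≡ false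
  bound⇒¬free {i} {β} {u} ne with free i in eq
  ... | true  = contradiction (z-free eq β u) ne
  ... | false = refl

  -- A free direction changes no code, and a correction of type `j` changes no code of the other
  -- type.
  edge-sym : ∀ i u → Edge i u → Edge i (toggle i u)
  edge-sym i u (inj₁ (fr , (t , d) , ¬d)) rewrite type-self i u fr =
    inj₁ (fr , (t , trans (z-free fr _ u) d) , λ (t′ , d′) → ¬d (t′ , trans (sym (z-free fr _ u)) d′))
  edge-sym i u (inj₂ (j , (t , ne) , ¬d)) =
    inj₂ (j , (t , subst (λ v → z _ v ≢ z _ (toggle i u)) (sym (toggle-involutive i u)) (ne ∘ sym)) ,
      λ (t′ , d′) → ¬d (t′ , trans (sym (z-other u ne (not≢ ∘ ,-injectiveˡ))) d′))

  H : Graph (Cube n)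
  H = record
    { Adj        = λ u v → ∃[ i ] v ≡ toggle i u × Edge i u
    ; adj?       = λ u v → Fin.any? λ i → (v ≟ᶜ toggle i u) ×-dec edge? i u
    ; adj-sym    = λ { {u} (i , refl , ok) → i , sym (toggle-involutive i u) , edge-sym i u ok }
    ; adj-irrefl = λ { {u} (i , eq , _) →
        not-¬ (cong (λ v → lookup v i) eq) (sym (trans (cong not (lookup-toggle i u)) (not-involutive _))) }
    }

  H⊆Q : H ⊆ᴳ Q n
  H⊆Q {u} (i , refl , _) = toggle-adj i u

  -- Absence of copies of `Q (suc k)` in `H`.

  module _ (κ : Copy (Q (suc k)) H) where
    open Copy κ

    private
      H⊆Q′ : H ⊆ᴳ Q n
      H⊆Q′ {u} {v} = H⊆Q {u} {v}

      origin : Cube (suc k)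
      origin = replicate _ false

      d : Fin (suc k) → Fin n
      d = direction H⊆Q′ κ origin

      d-injective : Injective _≡_ _≡_ d
      d-injective = direction-injective H⊆Q′ κ origin

      -- `direction-toggle` carries the direction from the origin to every other vertex, so the copy
      -- is a subcube with the directions `d`.
      direction-d : ∀ x c → direction H⊆Q′ κ x c ≡ d c
      direction-d x c = invariant⇒constant (λ y → direction H⊆Q′ κ y c)
        (λ y e → direction-toggle H⊆Q′ κ y c e) x origin

      to-d : ∀ x c → to (toggle c x) ≡ toggle (d c) (to x)
      to-d x c = trans (to-toggle H⊆Q′ κ x c) (cong (λ i → toggle i (to x)) (direction-d x c))

      edge : ∀ x c → Edge (d c) (to x)
      edge x c with preserves {x} (toggle-adj c x)
      ... | i , eq , ok =
        subst (λ i → Edge i (to x)) (toggle-injective (to x) (trans (sym eq) (to-d x c))) ok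

      Touches : Fin (suc k) → Bool × Fin k → Set
      Touches c β = ∀ x → z β (toggle (d c) (to x)) ≢ z β (to x)

      bound-edge : ∀ {c β} → Touches c β → ∀ x → BoundEdge (d c) (to x)
      bound-edge {c} {β} touch x with edge x c
      ... | inj₁ (fr , _) = contradiction (z-free fr β (to x)) (touch x)
      ... | inj₂ b        = b

      free-edge : ∀ {c} → free (d c) ≡ true → ∀ x → FreeEdge (d c) (to x)
      free-edge {c} fr x with edge x c
      ... | inj₁ b = b
      ... | inj₂ (_ , (_ , ne) , _) = contradiction (z-free fr _ (to x)) ne

      -- Whether a direction is free, and to which block it belongs, does not depend on the vertex;
      -- the edge at the origin decides for the whole copy.
      classify : ∀ c → free (d c) ≡ true ⊎ ∃[ β ] Touches c β
      classify c with edge origin c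
      ... | inj₁ (fr , _) = inj₁ fr
      ... | inj₂ (j , (t , ne) , _) = inj₂ ((j , t) , touch)
        where
        touch : Touches c (j , t)
        touch x with edge x c
        ... | inj₁ (fr , _) = contradiction (z-free fr _ _) ne
        ... | inj₂ (j′ , (t′ , ne′) , _) with refl ← z-block ne′ ne = ne′

      ¬D-other : ∀ {c j t} → Touches c (j , t) → ∀ x → ¬ D (not j) (to x)
      ¬D-other touch x with bound-edge touch x
      ... | j , (t , ne) , ¬d with refl ← z-block ne (touch x) = ¬d

      false-vertex : ∀ {c β} → Touches c β → ∃[ x ] z β (to x) ≡ false
      false-vertex {c} {β} touch with z β (to origin) in eq
      ... | false = origin , eq
      ... | true  = toggle c origin ,
        trans (¬-not (λ p → touch origin (trans (sym (cong (z β) (to-d origin c))) p))) (cong not eq)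

      touched : ∀ {c β} → Touches c β → ∀ x → z β (to (toggle c x)) ≡ not (z β (to x))
      touched {c} {β} touch x = trans (cong (z β) (to-d x c)) (¬-not (touch x))

      -- Moving along `c′` changes the type of the edge in direction `c` but no code, so the origin
      -- would both lie in and avoid the codes of one type.
      one-free : ∀ {c c′} → free (d c) ≡ true → free (d c′) ≡ true → c ≡ c′
      one-free {c} {c′} fr fr′ with c Fin.≟ c′
      ... | yes p   = p
      ... | no c≢c′ with free-edge fr origin | free-edge fr (toggle c′ origin)
      ...   | _ , _ , ¬D | _ , (t , D′) , _ = contradiction (t , (begin
          z (not (type (d c) (to origin)) , t) (to origin)
            ≡⟨ z-free fr′ _ _ ⟨
          z (not (type (d c) (to origin)) , t) (toggle (d c′) (to origin))
            ≡⟨ cong (λ j → z (j , t) (toggle (d c′) (to origin)))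
                    (type-free (to origin) (c≢c′ ∘ d-injective) fr′) ⟨
          z (type (d c) (toggle (d c′) (to origin)) , t) (toggle (d c′) (to origin))
            ≡⟨ cong (λ v → z (type (d c) v , t) v) (to-d origin c′) ⟨
          z (type (d c) (to (toggle c′ origin)) , t) (to (toggle c′ origin))
            ≡⟨ D′ ⟩
          true ∎)) ¬D
        where open ≡-Reasoning

      -- At a vertex of the copy outside the code both directions correct it, and the corrector is
      -- unique.
      one-per-block : ∀ {c c′ β} → Touches c β → Touches c′ β → c ≡ c′
      one-per-block {c} {c′} {β} touch touch′ with false-vertex touch
      ... | x , zx = d-injective (corrector-unique zx
        (trans (¬-not (touch x)) (cong not zx)) (trans (¬-not (touch′ x)) (cong not zx)))

      -- Some vertex of the copy is a codeword of type `j`, while a correction of the other type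
      -- excludes such codewords from the whole copy.
      same-type : ∀ {c c′ j j′ t t′} → Touches c (j , t) → Touches c′ (j′ , t′) → j ≡ j′
      same-type {c} {c′} {j} {j′} {t} touch touch′ with j Bool.≟ j′
      ... | yes p  = p
      ... | no j≢j′ with false-vertex touch
      ...   | x , zx = contradiction
        (t , trans (cong (λ j → z (j , t) (to (toggle c x))) (sym (¬-not j≢j′)))
                   (trans (touched touch x) (cong not zx)))
        (¬D-other touch′ (toggle c x))

      AvoidsCode : Cube (suc k) → Fin (suc k) → Set
      AvoidsCode x c = ∀ β → Touches c β → z β (to x) ≡ false

      -- Greedy: if the vertex lies in the code touched by `c`, move along `c`. This leaves the
      -- codes of the other blocks alone, so the conditions met before survive.
      avoid : ∀ cs → ∃[ x ] All (AvoidsCode x) cs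
      avoid [] = origin , []
      avoid (c ∷ cs) with avoid cs | classify c
      ... | x , av | inj₁ fr = x , (λ β touch → contradiction (z-free fr β (to x)) (touch x)) ∷ av
      ... | x , av | inj₂ (β , touch) with z β (to x) in zx
      ...   | false = x , (λ γ touch′ → trans (cong (λ β → z β (to x)) (z-block (touch′ x) (touch x))) zx) ∷ av
      ...   | true  = toggle c x , now ∷ All.map keep av
        where
        now : AvoidsCode (toggle c x) c
        now γ touch′ = trans (touched touch′ x)
          (cong not (trans (cong (λ β → z β (to x)) (z-block (touch′ x) (touch x))) zx))
        keep : ∀ {c′} → AvoidsCode x c′ → AvoidsCode (toggle c x) c′
        keep {c′} av γ touch′ with ≡-dec Bool._≟_ Fin._≟_ γ β
        ... | no γ≢β = trans (cong (z γ) (to-d x c)) (trans (z-other (to x) (touch x) γ≢β) (av γ touch′))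
        ... | yes refl with refl ← one-per-block touch touch′ = now γ touch′

      -- A free direction takes the default `t₀`, chosen in `some-free` to differ from the numbers
      -- of all touched blocks.
      block-number : ∀ {c} → Fin k → (free (d c) ≡ true ⊎ ∃[ β ] Touches c β) → Fin k
      block-number t₀ (inj₁ _)              = t₀
      block-number t₀ (inj₂ ((j , t) , _)) = t

      bound-injective : ∀ {c c′ j j′ t t′} → Touches c (j , t) → Touches c′ (j′ , t′) → t ≡ t′ → c ≡ c′
      bound-injective touch touch′ refl with refl ← same-type touch touch′ = one-per-block touch touch′

      too-many : (f : Fin (suc k) → Fin k) → ¬ Injective _≡_ _≡_ f
      too-many f inj = 1+n≰n (Fin.injective⇒≤ inj)

      -- All `suc k` directions would be corrections of one type in different blocks, but each type
      -- has only `k` blocks.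
      no-free : ¬ (∀ c → free (d c) ≢ true)
      no-free ¬fr = too-many number λ {c} {c′} → inj c c′
        where
        block : ∀ c → ∃[ β ] Touches c β
        block c with classify c
        ... | inj₁ fr = contradiction fr (¬fr c)
        ... | inj₂ b  = b
        number : Fin (suc k) → Fin k
        number c = proj₂ (proj₁ (block c))
        inj : ∀ c c′ → number c ≡ number c′ → c ≡ c′
        inj c c′ = bound-injective (proj₂ (block c)) (proj₂ (block c′))

      -- The number t₀ of a code through the free edge at x is not used by any
      -- bound direction, as x avoids the codes of all of these.
      some-free : ∀ c₀ → free (d c₀) ≢ true
      some-free c₀ fr₀ with avoid (allFin _)
      ... | x , av with free-edge fr₀ x
      ...   | _ , (t₀ , zx) , _ = too-many (λ c → block-number t₀ (classify c)) λ {c} {c′} → inj c c′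
        where
        clash : ∀ {c j t} → Touches c (j , t) → t₀ ≢ t
        clash {c} {j} touch refl with j Bool.≟ type (d c₀) (to x)
        ... | yes refl = contradiction (trans (sym zx) (All.lookup av (∈-allFin c) _ touch)) λ ()
        -- The free edge puts `x` in a code of its own type, which a correction of the other type
        -- forbids.
        ... | no  ne   = ¬D-other touch x
          (t₀ , trans (cong (λ j → z (j , t₀) (to x)) (sym (¬-not (ne ∘ sym)))) zx)
        inj : ∀ c c′ → block-number t₀ (classify c) ≡ block-number t₀ (classify c′) → c ≡ c′
        inj c c′ eq with classify c | classify c′
        ... | inj₁ fr          | inj₁ fr′          = one-free fr fr′
        ... | inj₁ _           | inj₂ (_ , touch′) = contradiction eq (clash touch′)
        ... | inj₂ (_ , touch) | inj₁ _            = contradiction (sym eq) (clash touch)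
        ... | inj₂ (_ , touch) | inj₂ (_ , touch′) = bound-injective touch touch′ eq

    H-free : ⊥
    H-free with Fin.any? (λ c → free (d c) Bool.≟ true)
    ... | yes (c , fr) = some-free c fr
    ... | no  ¬fr      = no-free (λ c fr → ¬fr (c , fr))

  -- Copies closed by free edges at vertices outside all codes.

  module _ {G : Graph (Cube n)} (H⊆G : H ⊆ᴳ G) {i : Fin n} {u : Cube n}
    (i-free : free i ≡ true) (uncoded : ∀ β → z β u ≡ false) (u≢v : u ≢ toggle i u) where

    private
      j : Bool
      j = type i u

      δ : Fin k → Fin n
      δ t = proj₁ (corrector (j , t) u (uncoded _))

      δ-touches : ∀ t → z (j , t) (toggle (δ t) u) ≢ z (j , t) u
      δ-touches t eq = contradiction
        (trans (sym (proj₂ (corrector (j , t) u (uncoded _)))) (trans eq (uncoded _))) λ ()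

      dir : Fin (suc k) → Fin n
      dir zero    = i
      dir (suc t) = δ t

      i≢δ : ∀ t → i ≢ δ t
      i≢δ t eq = δ-touches t (z-free (trans (cong free (sym eq)) i-free) _ u)

      dir-injective : Injective _≡_ _≡_ dir
      dir-injective {zero}  {zero}  _  = refl
      dir-injective {zero}  {suc t} eq = contradiction eq (i≢δ t)
      dir-injective {suc t} {zero}  eq = contradiction (sym eq) (i≢δ t)
      dir-injective {suc t} {suc t′} eq = cong suc (,-injectiveʳ (z-block (δ-touches t)
        (subst (λ i → z (j , t′) (toggle i u) ≢ z (j , t′) u) (sym eq) (δ-touches t′))))

      z-dir-other : ∀ {β} c → (∀ t → c ≡ suc t → β ≢ (j , t)) → ∀ v → z β (toggle (dir c) v) ≡ z β v
      z-dir-other zero    _  v = z-free i-free _ v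
      z-dir-other (suc t) ne v = z-other v (δ-touches t) (ne t refl)

      φ : Cube (suc k) → Cube n
      φ = embed dir u

      φ-¬D : ∀ x → ¬ D (not j) (φ x)
      φ-¬D x (t , zx) = contradiction (trans (sym zx) (trans
        (embed-invariant (z (not j , t)) dir (λ c → z-dir-other c (λ _ _ → not≢ ∘ ,-injectiveˡ)) u x)
        (uncoded _))) λ ()

      -- The code of `(j , t)` is changed only by `δ t`, which leads from outside it at `u` into it.
      -- So the bits of `x` after the first record the codes of type `j`.
      φ-z : ∀ x t → z (j , t) (φ x) ≡ lookup x (suc t)
      φ-z x t = trans
        (embed-sensitive (z (j , t)) dir (suc t)
          (λ c c≢t → z-dir-other c (λ t′ c≡t′ eq → c≢t (trans c≡t′ (cong suc (sym (,-injectiveʳ eq)))))) u x)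
        (bit (lookup x (suc t)))
        where
        bit : ∀ b → z (j , t) (toggleIf b (δ t) u) ≡ b
        bit false = uncoded _
        bit true  = proj₂ (corrector (j , t) u (uncoded _))

      φ-type : ∀ x → type i (φ x) ≡ j
      φ-type x = embed-invariant (type i) dir inv u x
        where
        inv : ∀ c v → type i (toggle (dir c) v) ≡ type i v
        inv zero    v = type-self i v i-free
        inv (suc t) v = type-bound v (i≢δ t) (bound⇒¬free (δ-touches t))

      G⁺ : Graph (Cube n)
      G⁺ = addEdge _≟ᶜ_ G u (toggle i u) u≢v

      -- Corrections lie in `H`, as no vertex is a codeword of the other type. A free edge lies in
      -- `H` as soon as some correction has been made; the only one left is the added edge.
      φ-edge : ∀ c x → Adj G⁺ (φ x) (toggle (dir c) (φ x))
      φ-edge (suc t) x = inj₁ (H⊆G (δ t , refl , inj₂ (j , (t , ne) , φ-¬D x)))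
        where
        ne : z (j , t) (toggle (δ t) (φ x)) ≢ z (j , t) (φ x)
        ne eq = not≢ (begin
          not (lookup x (suc t))           ≡⟨ lookup-toggle (suc t) x ⟨
          lookup (toggle (suc t) x) (suc t) ≡⟨ φ-z (toggle (suc t) x) t ⟨
          z (j , t) (φ (toggle (suc t) x)) ≡⟨ cong (z (j , t)) (embed-toggle dir (suc t) u x) ⟩
          z (j , t) (toggle (δ t) (φ x))   ≡⟨ eq ⟩
          z (j , t) (φ x)                  ≡⟨ φ-z x t ⟩
          lookup x (suc t)                 ∎)
          where open ≡-Reasoning
      φ-edge zero (b ∷ x) with Fin.any? (λ t → lookup x t Bool.≟ true)
      ... | yes (t , xt) = inj₁ (H⊆G (i , refl , inj₁ (i-free , in-D , not-in-D)))
        where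
        in-D : D (type i (φ (b ∷ x))) (φ (b ∷ x))
        in-D = subst (λ j → D j (φ (b ∷ x))) (sym (φ-type (b ∷ x))) (t , trans (φ-z (b ∷ x) t) xt)
        not-in-D : ¬ D (not (type i (φ (b ∷ x)))) (φ (b ∷ x))
        not-in-D = subst (λ j → ¬ D (not j) (φ (b ∷ x))) (sym (φ-type (b ∷ x))) (φ-¬D (b ∷ x))
      ... | no ¬true = inj₂ (new b φ-b)
        where
        x≡0 : x ≡ replicate k false
        x≡0 = lookup-ext x _ λ t → trans (¬-not (λ xt → ¬true (t , xt))) (sym (lookup-replicate t false))
        φ-b : φ (b ∷ x) ≡ toggleIf b i u
        φ-b = trans (cong (λ x → φ (b ∷ x)) x≡0) (embed-origin δ (toggleIf b i u))
        -- The bit `b` tells at which end of the added edge the vertex lies.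
        new : ∀ b {w} → w ≡ toggleIf b i u →
              (w ≡ u × toggle i w ≡ toggle i u) ⊎ (w ≡ toggle i u × toggle i w ≡ u)
        new false refl = inj₁ (refl , refl)
        new true  refl = inj₂ (refl , toggle-involutive i u)

    -- The edge may already belong to `G`. In `cover` it does, so that `G` itself would contain a
    -- copy.
    completes : Copy (Q (suc k)) G⁺
    completes = record
      { to        = φ
      ; injective = embed-injective dir dir-injective u
      ; preserves = λ {x} {y} → preserves {x} {y}
      }
      where
      preserves : ∀ {x y} → Adj (Q (suc k)) x y → Adj G⁺ (φ x) (φ y)
      preserves {x} {y} xy with c , refl ← adj⇒toggle x y xy =
        subst (Adj G⁺ (φ x)) (sym (embed-toggle dir c u x)) (φ-edge c x)

-- Hamming codes

infixr 6 _⊕_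
_⊕_ : Cube m → Cube m → Cube m
_⊕_ = zipWith _xor_

0ᶜ : Cube m
0ᶜ = replicate _ false

⊕-self : ∀ (u : Cube m) → u ⊕ u ≡ 0ᶜ
⊕-self []      = refl
⊕-self (b ∷ u) = cong₂ _∷_ (xor-same b) (⊕-self u)

⊕-identityˡ : ∀ (u : Cube m) → 0ᶜ ⊕ u ≡ u
⊕-identityˡ = zipWith-identityˡ (λ _ → refl)

⊕-assoc : ∀ (u v w : Cube m) → (u ⊕ v) ⊕ w ≡ u ⊕ v ⊕ w
⊕-assoc = zipWith-assoc xor-assoc

⊕-comm : ∀ (u v : Cube m) → u ⊕ v ≡ v ⊕ u
⊕-comm = zipWith-comm xor-comm

⊕-cancel : ∀ (u v : Cube m) → u ⊕ u ⊕ v ≡ v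
⊕-cancel u v = trans (sym (⊕-assoc u u v)) (trans (cong (_⊕ v) (⊕-self u)) (⊕-identityˡ v))

⊕-swap : ∀ (u v w : Cube m) → u ⊕ v ⊕ w ≡ v ⊕ u ⊕ w
⊕-swap u v w = trans (sym (⊕-assoc u v w)) (trans (cong (_⊕ w) (⊕-comm u v)) (⊕-assoc v u w))

⊕-zero⇒≡ : ∀ (u v : Cube m) → u ⊕ v ≡ 0ᶜ → u ≡ v
⊕-zero⇒≡ u v eq = begin
  u           ≡⟨ ⊕-identityˡ u ⟨
  0ᶜ ⊕ u      ≡⟨ ⊕-comm 0ᶜ u ⟩
  u ⊕ 0ᶜ      ≡⟨ cong (u ⊕_) eq ⟨
  u ⊕ u ⊕ v   ≡⟨ ⊕-cancel u v ⟩
  v           ∎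
  where open ≡-Reasoning

-- The product, over the field with two elements, of the matrix with columns `w i` and the vector
-- `u`.
syndrome : (Fin n → Cube m) → Cube n → Cube m
syndrome w []      = 0ᶜ
syndrome w (b ∷ u) = (if b then w zero else 0ᶜ) ⊕ syndrome (w ∘ suc) u

syndrome-toggle : ∀ (w : Fin n → Cube m) i u → syndrome w (toggle i u) ≡ w i ⊕ syndrome w u
syndrome-toggle w zero    (false ∷ u) = cong (w zero ⊕_) (sym (⊕-identityˡ _))
syndrome-toggle w zero    (true ∷ u)  = trans (⊕-identityˡ _) (sym (⊕-cancel (w zero) _))
syndrome-toggle w (suc i) (b ∷ u)     = trans
  (cong (_ ⊕_) (syndrome-toggle (w ∘ suc) i u)) (⊕-swap (if b then w zero else 0ᶜ) (w (suc i)) _)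

-- A coordinate labelled (β , v) is the column v of the parity check matrix of
-- the Hamming code of block β; unlabelled coordinates are free.  The superfluous
-- column v = 0 is harmless, as toggling it changes no syndrome.
module HammingCodes {n k r : ℕ}
  (label     : Fin n → Maybe ((Bool × Fin k) × Cube r))
  (coord     : (Bool × Fin k) × Cube r → Fin n)
  (label-coord : ∀ l → label (coord l) ≡ just l)
  (coord-label : ∀ {i l} → label i ≡ just l → i ≡ coord l)
  where

  Block : Set
  Block = Bool × Fin k

  _≟ᵇ_ : (β γ : Block) → Dec (β ≡ γ)
  _≟ᵇ_ = ≡-dec Bool._≟_ Fin._≟_

  column : Maybe (Block × Cube r) → Block → Cube r
  column nothing        β = 0ᶜ
  column (just (γ , v)) β = if does (γ ≟ᵇ β) then v else 0ᶜ

  column-same : ∀ β v → column (just (β , v)) β ≡ v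
  column-same β v with β ≟ᵇ β
  ... | yes _ = refl
  ... | no ne = contradiction refl ne

  column-≢0 : ∀ l β → column l β ≢ 0ᶜ → l ≡ just (β , column l β)
  column-≢0 nothing        β ne = contradiction refl ne
  column-≢0 (just (γ , v)) β ne with γ ≟ᵇ β
  ... | yes refl = refl
  ... | no _     = contradiction refl ne

  free : Fin n → Bool
  free i = is-nothing (label i)

  syn : Block → Cube n → Cube r
  syn β = syndrome (λ i → column (label i) β)

  code? : ∀ β u → Dec (syn β u ≡ 0ᶜ)
  code? β u = syn β u ≟ᶜ 0ᶜ

  z : Block → Cube n → Bool
  z β u = does (code? β u)

  z-true : ∀ β u → z β u ≡ true → syn β u ≡ 0ᶜ
  z-true β u eq with yes p ← code? β u = p

  true-z : ∀ β u → syn β u ≡ 0ᶜ → z β u ≡ true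
  true-z β u eq with code? β u
  ... | yes _ = refl
  ... | no ne = contradiction eq ne

  -- A syndrome with a single row, which marks the free coordinates; `syndrome-toggle` then applies
  -- to it too.
  parity : Cube n → Bool
  parity u = lookup (syndrome (λ i → free i ∷ []) u) zero

  parity-toggle : ∀ i u → parity (toggle i u) ≡ free i xor parity u
  parity-toggle i u = trans
    (cong (λ v → lookup v zero) (syndrome-toggle (λ i → free i ∷ []) i u))
    (lookup-zipWith _xor_ zero (free i ∷ []) (syndrome (λ i → free i ∷ []) u))

  syn-fixed : ∀ {i β} → column (label i) β ≡ 0ᶜ → ∀ u → syn β (toggle i u) ≡ syn β u
  syn-fixed {i} {β} eq u = trans (syndrome-toggle _ i u)
    (trans (cong (_⊕ syn β u) eq) (⊕-identityˡ (syn β u)))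

  z-free : ∀ {i} → free i ≡ true → ∀ β u → z β (toggle i u) ≡ z β u
  z-free {i} fr β u with nothing ← label i in eq =
    cong (λ s → does (s ≟ᶜ 0ᶜ)) (syn-fixed {i} {β} (cong (λ l → column l β) eq) u)

  -- A flip adds its column to the syndrome, so a change of membership needs a non-zero column, and
  -- a coordinate has one only in the block of its label.
  touches⇒label : ∀ i β u → z β (toggle i u) ≢ z β u → label i ≡ just (β , column (label i) β)
  touches⇒label i β u ne = column-≢0 (label i) β
    (λ eq → ne (cong (λ s → does (s ≟ᶜ 0ᶜ)) (syn-fixed {i} {β} eq u)))

  z-block : ∀ {i β γ u v} → z β (toggle i u) ≢ z β u → z γ (toggle i v) ≢ z γ v → β ≡ γ
  z-block {i} {β} {γ} {u} {v} ne ne′ = ,-injectiveˡ (just-injective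
    (trans (sym (touches⇒label i β u ne)) (touches⇒label i γ v ne′)))

  syn-coord : ∀ β v u → syn β (toggle (coord (β , v)) u) ≡ v ⊕ syn β u
  syn-coord β v u = trans (syndrome-toggle _ (coord (β , v)) u) (cong (_⊕ syn β u)
    (trans (cong (λ l → column l β) (label-coord (β , v))) (column-same β v)))

  -- Every vector is a column of the block; flipping the coordinate whose column is the syndrome
  -- cancels it.
  corrector : ∀ β u → z β u ≡ false → ∃[ i ] z β (toggle i u) ≡ true
  corrector β u _ = coord (β , syn β u) ,
    true-z β (toggle (coord (β , syn β u)) u) (trans (syn-coord β (syn β u) u) (⊕-self (syn β u)))

  -- The column of a correcting coordinate must equal the syndrome, and a label belongs to only one
  -- coordinate.
  corrects⇒coord : ∀ β u i → z β u ≡ false → z β (toggle i u) ≡ true → i ≡ coord (β , syn β u)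
  corrects⇒coord β u i eq eq′ = coord-label (trans
    (touches⇒label i β u λ p → contradiction (trans (sym eq′) (trans p eq)) λ ())
    (cong (λ v → just (β , v)) (⊕-zero⇒≡ (column (label i) β) (syn β u)
      (trans (sym (syndrome-toggle _ i u)) (z-true β (toggle i u) eq′)))))

  corrector-unique : ∀ {β u i j} → z β u ≡ false →
    z β (toggle i u) ≡ true → z β (toggle j u) ≡ true → i ≡ j
  corrector-unique {β} {u} eq zi zj =
    trans (corrects⇒coord β u _ eq zi) (sym (corrects⇒coord β u _ eq zj))

  -- All cosets of a code have the same size.
  code-size : ∀ β → 2 ^ r * ∑ (vertices n) (λ u → ι (z β u)) ≡ 2 ^ n
  code-size β = begin
    2 ^ r * ∑ (vertices n) (λ u → # (syn β u ≟ᶜ 0ᶜ))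
      ≡⟨ ∑-vertices-const r _ ⟨
    ∑ (vertices r) (λ _ → ∑ (vertices n) (λ u → # (syn β u ≟ᶜ 0ᶜ)))
      ≡⟨ ∑-cong coset (vertices r) ⟩
    ∑ (vertices r) (λ v → ∑ (vertices n) (λ u → # (syn β u ≟ᶜ v)))
      ≡⟨ ∑-swap (λ v u → # (syn β u ≟ᶜ v)) (vertices r) (vertices n) ⟩
    ∑ (vertices n) (λ u → ∑ (vertices r) (λ v → # (syn β u ≟ᶜ v)))
      ≡⟨ ∑-cong (λ u → trans
           (∑-single (syn β u) (λ v → # (syn β u ≟ᶜ v)) (λ v v≢ → #-no (syn β u ≟ᶜ v) (v≢ ∘ sym)))
           (#-yes (syn β u ≟ᶜ syn β u) refl)) (vertices n) ⟩
    ∑ (vertices n) (λ _ → 1)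
      ≡⟨ trans (∑-vertices-const n 1) (*-identityʳ _) ⟩
    2 ^ n ∎
    where
    open ≡-Reasoning
    -- Flipping the coordinate with column `v` permutes the vertices and shifts the syndrome by `v`.
    coset : ∀ v → ∑ (vertices n) (λ u → # (syn β u ≟ᶜ 0ᶜ)) ≡ ∑ (vertices n) (λ u → # (syn β u ≟ᶜ v))
    coset v = trans
      (∑-cong (λ u → #-cong (syn β u ≟ᶜ 0ᶜ) (syn β (toggle (coord (β , v)) u) ≟ᶜ v)
        (λ eq → trans (syn-coord β v u) (trans (cong (v ⊕_) eq) (trans (⊕-comm v 0ᶜ) (⊕-identityˡ v))))
        (λ eq → trans (sym (⊕-cancel v (syn β u)))
          (trans (cong (v ⊕_) (trans (sym (syn-coord β v u)) eq)) (⊕-self v)))) (vertices n))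
      (∑-toggle (coord (β , v)) (λ u → # (syn β u ≟ᶜ v)))

-- Labels of the coordinates.

cube↔ : ∀ r → Fin (2 ^ r) ↔ Cube r
cube↔ zero    = mk↔ₛ′ (λ _ → []) (λ _ → zero) (λ { [] → refl }) (λ { zero → refl })
cube↔ (suc r) = ↔-trans Fin.*↔× (↔-trans (Fin.2↔Bool ×-↔ cube↔ r)
  (mk↔ₛ′ (uncurry _∷_) (λ { (b ∷ u) → b , u }) (λ { (b ∷ u) → refl }) (λ _ → refl)))

blocks↔ : ∀ k → Fin (2 * k) ↔ (Bool × Fin k)
blocks↔ k = ↔-trans Fin.*↔× (Fin.2↔Bool ×-↔ ↔-refl)

labels↔ : ∀ k r → Fin (2 * k * 2 ^ r) ↔ ((Bool × Fin k) × Cube r)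
labels↔ k r = ↔-trans Fin.*↔× (blocks↔ k ×-↔ cube↔ r)

module Labelling {K : ℕ} {L : Set} (f : Fin K ↔ L) (n : ℕ) where

  label : Fin (K + n) → Maybe L
  label i = [ just ∘ Inverse.to f , const nothing ]′ (splitAt K i)

  coord : L → Fin (K + n)
  coord l = Inverse.from f l ↑ˡ n

  label-coord : ∀ l → label (coord l) ≡ just l
  label-coord l rewrite Fin.splitAt-↑ˡ K (Inverse.from f l) n = cong just (Inverse.strictlyInverseˡ f l)

  coord-label : ∀ {i l} → label i ≡ just l → i ≡ coord l
  coord-label {i} eq with splitAt K i in split
  coord-label {i} refl | inj₁ j = trans (sym (Fin.splitAt⁻¹-↑ˡ split))
    (cong (_↑ˡ n) (sym (Inverse.strictlyInverseʳ f j)))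

  labelled-count : ∑ (allFin (K + n)) (λ i → ι (not (is-nothing (label i)))) ≤ K
  labelled-count = ∑-initial K _ (λ i → ι≤1 _) unlabelled
    where
    ι≤1 : ∀ b → ι b ≤ 1
    ι≤1 false = z≤n
    ι≤1 true  = s≤s z≤n
    unlabelled : ∀ i → ι (not (is-nothing (label (K ↑ʳ i)))) ≡ 0
    unlabelled i rewrite Fin.splitAt-↑ʳ K n i = refl

-- Existence of the saturation number

-- Functions on a cube as data, to search through them without extensionality.
Table : ℕ → Set → Set
Table zero    A = A
Table (suc n) A = Table n A × Table n A

search-Table : ∀ n → Searchable A → Searchable (Table n A)
search-Table zero    search = search
search-Table (suc n) search = search-× (search-Table n search) (search-Table n search)

at : Table n A → Cube n → A
at t       []          = t
at (t , _) (false ∷ u) = at t u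
at (_ , t) (true ∷ u)  = at t u

table : (Cube n → A) → Table n A
table {zero}  f = f []
table {suc n} f = table (f ∘ (false ∷_)) , table (f ∘ (true ∷_))

at-table : ∀ (f : Cube n → A) u → at (table f) u ≡ f u
at-table f []          = refl
at-table f (false ∷ u) = at-table (f ∘ (false ∷_)) u
at-table f (true ∷ u)  = at-table (f ∘ (true ∷_)) u

copy-mono : ∀ {W V : Set} {F : Graph W} {G G′ : Graph V} → G ⊆ᴳ G′ → Copy F G → Copy F G′
copy-mono G⊆G′ κ = record
  { to        = to
  ; injective = injective
  ; preserves = λ {x} {y} a → G⊆G′ (preserves {x} {y} a)
  }
  where open Copy κ

copy? : ∀ (G : Graph (Cube n)) → Dec (Copy (Q m) G)
copy? {n} {m} G = map′ to-copy from-copy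
  (search-Table m (search-Cube n) λ t → injective? t ×-dec preserves? t)
  where
  Inj Pres : Table m (Cube n) → Set
  Inj  t = ∀ x y → at t x ≡ at t y → x ≡ y
  Pres t = ∀ x y → Adj (Q m) x y → Adj G (at t x) (at t y)
  injective? : ∀ t → Dec (Inj t)
  injective? t = search-all (search-Cube m) λ x → search-all (search-Cube m) λ y →
    (at t x ≟ᶜ at t y) →-dec (x ≟ᶜ y)
  preserves? : ∀ t → Dec (Pres t)
  preserves? t = search-all (search-Cube m) λ x → search-all (search-Cube m) λ y →
    adj? (Q m) x y →-dec adj? G (at t x) (at t y)
  to-copy : (∃[ t ] Inj t × Pres t) → Copy (Q m) G
  to-copy (t , inj , pres) = record
    { to = at t ; injective = inj _ _ ; preserves = λ {x} {y} → pres x y }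
  from-copy : Copy (Q m) G → ∃[ t ] Inj t × Pres t
  from-copy κ = table to ,
    (λ x y eq → injective (trans (sym (at-table to x)) (trans eq (at-table to y)))) ,
    λ x y a → subst₂ (Adj G) (sym (at-table to x)) (sym (at-table to y)) (preserves {x} {y} a)
    where open Copy κ

∈-vertices : ∀ (u : Cube n) → u ∈ vertices n
∈-vertices []          = here refl
∈-vertices (false ∷ u) = ∈-++⁺ˡ (∈-map⁺ (false ∷_) (∈-vertices u))
∈-vertices {suc n} (true ∷ u)  = ∈-++⁺ʳ (map (false ∷_) (vertices n)) (∈-map⁺ (true ∷_) (∈-vertices u))

module _ (m n : ℕ) where

  Blocked : Graph (Cube n) → Cube n × Cube n → Set
  Blocked G (u , v) = (uv : Adj (Q n) u v) → ¬ Adj G u v → Copy (Q m) (addEdge _≟ᶜ_ G u v (Q-≢ uv))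

  -- The copy that blocks an edge survives in a larger graph, so `extend` need not return to a pair.
  blocked-mono : ∀ {G G′} → G ⊆ᴳ G′ → ∀ {p} → Blocked G p → Blocked G′ p
  blocked-mono {G} {G′} G⊆G′ {u , v} blocked uv ¬a =
    copy-mono {G = addEdge _≟ᶜ_ G u v (Q-≢ uv)} {G′ = addEdge _≟ᶜ_ G′ u v (Q-≢ uv)}
      (λ {x} {y} → Sum.map₁ (G⊆G′ {x} {y})) (blocked uv (¬a ∘ G⊆G′))

  -- Greedy: each cube edge in the list is added unless this creates a copy.
  extend : (es : List (Cube n × Cube n)) (G : Graph (Cube n)) → G ⊆ᴳ Q n → Free (Q m) G →
           ∃[ G′ ] G ⊆ᴳ G′ × G′ ⊆ᴳ Q n × Free (Q m) G′ × All (Blocked G′) es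
  extend []              G G⊆Q fr = G , (λ a → a) , (λ {u} {v} → G⊆Q {u} {v}) , fr , []
  extend ((u , v) ∷ es) G G⊆Q fr with adj? (Q n) u v
  ... | no ¬uv with extend es G G⊆Q fr
  ...   | G′ , sub , rest , fr′ , all =
    G′ , (λ {x} {y} → sub {x} {y}) , (λ {x} {y} → rest {x} {y}) , fr′ , (λ uv → contradiction uv ¬uv) ∷ all
  extend ((u , v) ∷ es) G G⊆Q fr | yes uv with copy? {m = m} (addEdge _≟ᶜ_ G u v (Q-≢ uv))
  ... | yes κ with extend es G G⊆Q fr
  ...   | G′ , sub , rest , fr′ , all =
    G′ , (λ {x} {y} → sub {x} {y}) , (λ {x} {y} → rest {x} {y}) , fr′ ,
    -- `κ` was found for the adjacency proof `uv`; the graph built from `uv′` has the same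
    -- adjacency.
    blocked-mono {G} {G′} (λ {x} {y} → sub {x} {y}) (λ uv′ ¬a → copy-mono (λ a → a) κ) ∷ all
  extend ((u , v) ∷ es) G G⊆Q fr | yes uv | no ¬κ with extend es (addEdge _≟ᶜ_ G u v (Q-≢ uv)) G⁺⊆Q ¬κ
    where
    G⁺⊆Q : addEdge _≟ᶜ_ G u v (Q-≢ uv) ⊆ᴳ Q n
    G⁺⊆Q (inj₁ a) = G⊆Q a
    G⁺⊆Q (inj₂ (inj₁ (refl , refl))) = uv
    G⁺⊆Q (inj₂ (inj₂ (refl , refl))) = adj-sym (Q n) {u} {v} uv
  ... | G′ , sub , rest , fr′ , all =
    G′ , (λ {x} {y} a → sub {x} {y} (inj₁ a)) , (λ {x} {y} → rest {x} {y}) , fr′ ,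
    (λ _ ¬a → contradiction (sub (inj₂ (inj₁ (refl , refl)))) ¬a) ∷ all

  saturate : (G : Graph (Cube n)) → G ⊆ᴳ Q n → Free (Q m) G →
             ∃[ G′ ] G ⊆ᴳ G′ × Saturated n (Q m) G′
  saturate G G⊆Q fr with extend (cartesianProduct (vertices n) (vertices n)) G G⊆Q fr
  ... | G′ , sub , rest , fr′ , all = G′ , (λ {x} {y} → sub {x} {y}) , record
    { subgraph = λ {x} {y} → rest {x} {y}
    ; free     = fr′
    ; maximal  = λ {u} {v} uv ¬a → All.lookup all (∈-cartesianProduct⁺ (∈-vertices u) (∈-vertices v)) uv ¬a
    }

  saturated? : ∀ G → Dec (Saturated n (Q m) G)
  saturated? G = map′
    (λ (sub , fr , max) → record
      { subgraph = λ {u} {v} → sub u v ; free = fr ; maximal = λ {u} {v} uv ¬a → max u v uv ¬a })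
    (λ s → (λ u v → Saturated.subgraph s {u} {v}) , Saturated.free s , λ u v uv ¬a → Saturated.maximal s {u} {v} uv ¬a)
    (search-all (search-Cube n) (λ u → search-all (search-Cube n) λ v → adj? G u v →-dec adj? (Q n) u v)
      ×-dec ¬? (copy? G)
      ×-dec search-all (search-Cube n) λ u → search-all (search-Cube n) λ v → blocked? u v)
    where
    blocked? : ∀ u v → Dec (Blocked G (u , v))
    blocked? u v with adj? (Q n) u v | adj? G u v
    ... | no ¬uv | _     = yes λ uv → contradiction uv ¬uv
    ... | yes uv | yes a = yes λ _ ¬a → contradiction a ¬a
    ... | yes uv | no ¬a with copy? {m = m} (addEdge _≟ᶜ_ G u v (Q-≢ uv))
    ...   | yes κ = yes λ _ _ → copy-mono (λ a → a) κ
    ...   | no ¬κ = no λ b → ¬κ (b uv ¬a)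

  -- A table recovers a graph only up to mutual inclusion, so saturation has to be carried across.
  saturated-resp : ∀ {G G′} → G ⊆ᴳ G′ → G′ ⊆ᴳ G → Saturated n (Q m) G → Saturated n (Q m) G′
  saturated-resp {G} {G′} G⊆G′ G′⊆G s = record
    { subgraph = λ {u} {v} a → subgraph {u} {v} (G′⊆G a)
    ; free     = free ∘ copy-mono {G = G′} {G′ = G} (λ {u} {v} → G′⊆G {u} {v})
    ; maximal  = λ {u} {v} uv ¬a → blocked-mono {G} {G′} (λ {x} {y} → G⊆G′ {x} {y}) (maximal {u} {v}) uv ¬a
    }
    where open Saturated s

  GraphTable : Set
  GraphTable = Table n (Table n Bool)

  -- Restricted to cube edges and symmetrised, so that any table whatever yields a subgraph of the
  -- cube.
  graph : GraphTable → Graph (Cube n)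
  graph t = record
    { Adj        = λ u v → Adj (Q n) u v × (at (at t u) v ≡ true ⊎ at (at t v) u ≡ true)
    ; adj?       = λ u v → adj? (Q n) u v ×-dec
        ((at (at t u) v Bool.≟ true) ⊎-dec (at (at t v) u Bool.≟ true))
    ; adj-sym    = λ {u} {v} (uv , a) → adj-sym (Q n) {u} {v} uv , Sum.swap a
    ; adj-irrefl = λ {u} (uu , _) → adj-irrefl (Q n) {u} uu
    }

  graphTable : Graph (Cube n) → GraphTable
  graphTable G = table λ u → table λ v → does (adj? G u v)

  module _ {G : Graph (Cube n)} (G⊆Q : G ⊆ᴳ Q n) where

    private
      entry : ∀ u v → at (at (graphTable G) u) v ≡ does (adj? G u v)
      entry u v = trans (cong (λ t → at t v) (at-table (λ u → table λ v → does (adj? G u v)) u))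
        (at-table (λ v → does (adj? G u v)) v)

      entry⇒adj : ∀ u v → at (at (graphTable G) u) v ≡ true → Adj G u v
      entry⇒adj u v eq with adj? G u v | entry u v
      ... | yes a | _   = a
      ... | no _  | eq′ = contradiction (trans (sym eq) eq′) λ ()

    graph⊆ : graph (graphTable G) ⊆ᴳ G
    graph⊆ {u} {v} (_ , inj₁ eq) = entry⇒adj u v eq
    graph⊆ {u} {v} (_ , inj₂ eq) = adj-sym G (entry⇒adj v u eq)

    ⊆graph : G ⊆ᴳ graph (graphTable G)
    ⊆graph {u} {v} a = G⊆Q {u} {v} a , inj₁ (trans (entry u v) (does-true (adj? G u v)))
      where
      does-true : ∀ (d : Dec (Adj G u v)) → does d ≡ true
      does-true (yes _) = refl
      does-true (no ¬a) = contradiction a ¬a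

    e-graph : e (graph (graphTable G)) ≡ e G
    e-graph = begin
      e (graph (graphTable G))
        ≡⟨ length-filter (uncurry (adj? (graph (graphTable G)))) (pairs (vertices n)) ⟩
      ∑ (pairs (vertices n)) (λ (u , v) → # (adj? (graph (graphTable G)) u v))
        ≡⟨ ∑-cong (λ (u , v) → #-cong (adj? (graph (graphTable G)) u v) (adj? G u v)
             (graph⊆ {u} {v}) (⊆graph {u} {v})) (pairs (vertices n)) ⟩
      ∑ (pairs (vertices n)) (λ (u , v) → # (adj? G u v))
        ≡⟨ length-filter (uncurry (adj? G)) (pairs (vertices n)) ⟨
      e G ∎
      where open ≡-Reasoning

  -- Ranging over tables instead of graphs makes this decidable by search.
  Attained : ℕ → Set
  Attained s = ∃[ t ] Saturated n (Q m) (graph t) × e (graph t) ≡ s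

  attained? : Decidable Attained
  attained? s = search-Table n (search-Table n search-Bool) λ t →
    saturated? (graph t) ×-dec (e (graph t) ≟ s)

  attain : ∀ G → Saturated n (Q m) G → Attained (e G)
  attain G s = graphTable G ,
    saturated-resp {G} {graph (graphTable G)}
      (λ {u} {v} → ⊆graph {G} (λ {u} {v} → G⊆Q {u} {v}) {u} {v})
      (λ {u} {v} → graph⊆ {G} (λ {u} {v} → G⊆Q {u} {v}) {u} {v}) s ,
    e-graph {G} (λ {u} {v} → G⊆Q {u} {v})
    where
    G⊆Q : G ⊆ᴳ Q n
    G⊆Q {u} {v} = Saturated.subgraph s {u} {v}

least : ∀ {P : ℕ → Set} → Decidable P → ∀ k →
        (∃[ s ] P s × (∀ t → P t → s ≤ t)) ⊎ (∀ t → t < k → ¬ P t)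
least P? zero = inj₂ λ _ ()
least P? (suc k) with least P? k
... | inj₁ found = inj₁ found
... | inj₂ none with P? k
...   | yes p = inj₁ (k , p , λ t pt → ≮⇒≥ λ t<k → none t t<k pt)
...   | no ¬p = inj₂ below
  where
  below : ∀ t → t < suc k → ¬ _
  below t (s≤s t≤k) pt with m≤n⇒m<n∨m≡n t≤k
  ... | inj₁ t<k  = none t t<k pt
  ... | inj₂ refl = ¬p pt

emptyGraph : ∀ {V} → Graph V
emptyGraph = record { Adj = λ _ _ → ⊥ ; adj? = λ _ _ → no λ () ; adj-sym = λ () ; adj-irrefl = λ () }

-- A cube of positive dimension has an edge. The single vertex `Q 0` would have a copy in every
-- graph on `Cube n`.
emptyGraph-free : ∀ m n → Free (Q (suc m)) (emptyGraph {Cube n})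
emptyGraph-free m n κ = Copy.preserves κ {origin} {toggle zero origin} (toggle-adj zero origin)
  where
  origin : Cube (suc m)
  origin = replicate (suc m) false

sat-exists : ∀ m n → ∃[ s ] IsSat n (Q (suc m)) s
sat-exists m n with saturate (suc m) n emptyGraph (λ ()) (emptyGraph-free m n)
-- The successor makes the search include the attained value `e G` itself.
... | G , _ , G-sat with least (attained? (suc m) n) (suc (e G))
...   | inj₂ none = contradiction (attain (suc m) n G G-sat) (none (e G) ≤-refl)
...   | inj₁ (s , (t , t-sat , eq) , min) = s , record
  { attained = graph (suc m) n t , t-sat , eq
  ; minimum  = λ G′ G′-sat → min (e G′) (attain (suc m) n G′ G′-sat)
  }

-- The upper bound

module _ {n k r K : ℕ} (coding : Coding n k r K) where
  open Coding coding
  open Construction coding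

  private
    saturation : ∃[ G ] H ⊆ᴳ G × Saturated n (Q (suc k)) G
    saturation = saturate (suc k) n H (λ {u} {v} → H⊆Q {u} {v}) H-free

    G : Graph (Cube n)
    G = proj₁ saturation

    H⊆G : H ⊆ᴳ G
    H⊆G {u} {v} = proj₁ (proj₂ saturation) {u} {v}

    G-sat : Saturated n (Q (suc k)) G
    G-sat = proj₂ (proj₂ saturation)

    G⊆Q : G ⊆ᴳ Q n
    G⊆Q {u} {v} = Saturated.subgraph G-sat {u} {v}

    blocks : List (Bool × Fin k)
    blocks = map (Inverse.to (blocks↔ k)) (allFin (2 * k))

    ∈-blocks : ∀ β → β ∈ blocks
    ∈-blocks β = subst (_∈ blocks) (Inverse.strictlyInverseˡ (blocks↔ k) β)
      (∈-map⁺ (Inverse.to (blocks↔ k)) (∈-allFin (Inverse.from (blocks↔ k) β)))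

    length-blocks : length blocks ≡ 2 * k
    length-blocks = trans (length-map _ (allFin (2 * k))) (length-tabulate {n = 2 * k} id)

    -- If `u` were in no code, the free edge would close a copy; as it is already in `G`, that copy
    -- would lie in `G`.
    cover : ∀ u i → Adj G u (toggle i u) → free i ≡ false ⊎ ∃[ β ] β ∈ blocks × z β u ≡ true
    cover u i a with free i in i-free
    ... | false = inj₁ refl
    ... | true  with search-Bool (λ j → D? j u)
    ...   | yes (j , t , p) = inj₂ ((j , t) , ∈-blocks (j , t) , p)
    ...   | no uncoded      = contradiction
      (copy-mono {G = addEdge _≟ᶜ_ G u (toggle i u) u≢v} {G′ = G} G⁺⊆G
        (completes {G} (λ {x} {y} → H⊆G {x} {y}) {i} {u} i-free
          (λ (j , t) → ¬-not λ p → uncoded (j , t , p)) u≢v))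
      (Saturated.free G-sat)
      where
      u≢v : u ≢ toggle i u
      u≢v = Q-≢ {u = u} {v = toggle i u} (G⊆Q a)
      G⁺⊆G : addEdge _≟ᶜ_ G u (toggle i u) u≢v ⊆ᴳ G
      G⁺⊆G (inj₁ b)                    = b
      G⁺⊆G (inj₂ (inj₁ (refl , refl))) = a
      G⁺⊆G (inj₂ (inj₂ (refl , refl))) = adj-sym G {u} a

    codes : ℕ
    codes = ∑ blocks (λ β → ∑ (vertices n) (λ u → ι (z β u)))

    codes-size : 2 ^ r * codes ≡ 2 * k * 2 ^ n
    codes-size = begin
      2 ^ r * codes                                                  ≡⟨ ∑-*ˡ (2 ^ r) _ blocks ⟨
      ∑ blocks (λ β → 2 ^ r * ∑ (vertices n) (λ u → ι (z β u)))      ≡⟨ ∑-cong code-size blocks ⟩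
      ∑ blocks (λ _ → 2 ^ n)                                         ≡⟨ ∑-const (2 ^ n) blocks ⟩
      length blocks * 2 ^ n                                          ≡⟨ cong (_* 2 ^ n) length-blocks ⟩
      2 * k * 2 ^ n                                                  ∎
      where open ≡-Reasoning

    -- The factor `2 ^ r` clears the density of the codes, keeping the estimate in the natural
    -- numbers.
    bound : 2 ^ r * (2 * e G) ≤ 2 ^ n * (2 ^ r * K + n * (2 * k))
    bound = begin
      2 ^ r * (2 * e G)
        ≤⟨ *-monoʳ-≤ (2 ^ r) (edge-bound {G = G} (λ {u} {v} → G⊆Q {u} {v}) free z blocks cover) ⟩
      2 ^ r * (2 ^ n * ∑ (allFin n) (λ i → ι (not (free i))) + n * codes)
        ≤⟨ *-monoʳ-≤ (2 ^ r) (+-monoˡ-≤ (n * codes) (*-monoʳ-≤ (2 ^ n) bound-count)) ⟩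
      2 ^ r * (2 ^ n * K + n * codes)
        ≡⟨ expand (2 ^ r) (2 ^ n * K) n codes ⟩
      2 ^ r * (2 ^ n * K) + n * (2 ^ r * codes)
        ≡⟨ cong (λ c → 2 ^ r * (2 ^ n * K) + n * c) codes-size ⟩
      2 ^ r * (2 ^ n * K) + n * (2 * k * 2 ^ n)
        ≡⟨ collect (2 ^ r) (2 ^ n) K n (2 * k) ⟩
      2 ^ n * (2 ^ r * K + n * (2 * k)) ∎
      where
      open ≤-Reasoning
      expand : ∀ a b c d → a * (b + c * d) ≡ a * b + c * (a * d)
      expand = solve-∀
      collect : ∀ a b c d e → a * (b * c) + d * (e * b) ≡ b * (a * c + d * e)
      collect = solve-∀

  sat-bound : ∀ {s} → IsSat n (Q (suc k)) s →
              2 ^ r * (2 * s) ≤ 2 ^ n * (2 ^ r * K + n * (2 * k))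
  sat-bound isSat =
    ≤-trans (*-monoʳ-≤ (2 ^ r) (*-monoʳ-≤ 2 (IsSat.minimum isSat G G-sat))) bound

hamming-coding : ∀ k r n → Coding (2 * k * 2 ^ r + n) k r (2 * k * 2 ^ r)
hamming-coding k r n = record
  { free             = free
  ; parity           = parity
  ; z                = z
  ; parity-toggle    = parity-toggle
  ; z-free           = λ {i} → z-free {i}
  ; z-block          = λ {i} {β} {γ} {u} {v} → z-block {i} {β} {γ} {u} {v}
  ; corrector        = corrector
  ; corrector-unique = λ {β} {u} {i} {j} → corrector-unique {β} {u} {i} {j}
  ; bound-count      = labelled-count
  ; code-size        = code-size
  }
  where
  open Labelling (labels↔ k r) n
  open HammingCodes label coord label-coord (λ {i} {l} → coord-label {i} {l})

-- Passage to the limit.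

n≤2^n : ∀ n → n ≤ 2 ^ n
n≤2^n zero    = z≤n
n≤2^n (suc n) = ≤-trans (+-mono-≤ (m^n>0 2 n) (n≤2^n n))
  (≤-reflexive (cong (2 ^ n +_) (sym (+-identityʳ _))))

-- The hypothesis bounds the ratio by the inverse of the denominator of `ε`, and a positive `ε` has
-- numerator at least 1.
ratio-small : ∀ s E ε → 0ℚ ℚ.< ε → s * ↧ₙ ε < E → ℚ.∣ ratio s E ℚ.- 0ℚ ∣ ℚ.< ε
ratio-small s (suc E) (mkℚ (ℤ.+ zero)   q c) (ℚ.*<* (+<+ ())) _
ratio-small s (suc E) (mkℚ ℤ.-[1+ p ] q c) (ℚ.*<* ()) _
ratio-small s (suc E) ε@(mkℚ +[1+ p ] q c) _ lt = subst (ℚ._< ε) (sym abs) (ℚ.toℚᵘ-cancel-<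
  (ℚᵘ.<-respˡ-≃ (ℚᵘ.≃-sym (ℚ.toℚᵘ-fromℚᵘ (ℚᵘ.mkℚᵘ (ℤ.+ s) E))) (ℚᵘ.*<* cross)))
  where
  x : ℚ
  x = ratio s (suc E)
  abs : ℚ.∣ x ℚ.- 0ℚ ∣ ≡ x
  abs = trans (cong ℚ.∣_∣ (ℚ.+-identityʳ x))
    (ℚ.0≤p⇒∣p∣≡p (ℚ.nonNegative⁻¹ x {{ℚ.normalize-nonNeg s (suc E)}}))
  cross : (ℤ.+ s) ℤ.* (ℤ.+ suc q) ℤ.< (ℤ.+ suc p) ℤ.* (ℤ.+ suc E)
  cross = subst₂ ℤ._<_ (ℤ.pos-* s (suc q)) (ℤ.pos-* (suc p) (suc E))
    (+<+ (<-≤-trans lt (m≤m+n (suc E) (p * suc E))))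

-- Each of the two terms of the bound contributes at most half.
halves : ∀ R P n K M q s E .{{_ : NonZero R}} .{{_ : NonZero P}} →
  R * (2 * s) ≤ P * (R * K + n * M) → 2 * E ≡ P * n →
  2 * q * K < n → 2 * q * M ≤ R → s * q < E
halves R P n K M q s E bound 2E small-K small-M =
  -- `R` clears the code density; 4 combines the 2 of the degree sum with the 2 of the halves.
  *-cancelˡ-< (R * 4) (s * q) E (begin-strict
    R * 4 * (s * q)                             ≡⟨ lemma₁ R s q ⟩
    2 * q * (R * (2 * s))                       ≤⟨ *-monoʳ-≤ (2 * q) bound ⟩
    2 * q * (P * (R * K + n * M))               ≡⟨ lemma₂ q P R K n M ⟩
    P * (R * (2 * q * K) + n * (2 * q * M))     <⟨ *-monoʳ-< P (+-mono-<-≤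
                                                     (*-monoʳ-< R small-K) (*-monoʳ-≤ n small-M)) ⟩
    P * (R * n + n * R)                         ≡⟨ lemma₃ P R n ⟩
    R * 2 * (P * n)                             ≡⟨ cong (R * 2 *_) 2E ⟨
    R * 2 * (2 * E)                             ≡⟨ lemma₄ R E ⟩
    R * 4 * E                                   ∎)
  where
  open ≤-Reasoning
  lemma₁ : ∀ R s q → R * 4 * (s * q) ≡ 2 * q * (R * (2 * s))
  lemma₁ = solve-∀
  lemma₂ : ∀ q P R K n M → 2 * q * (P * (R * K + n * M)) ≡ P * (R * (2 * q * K) + n * (2 * q * M))
  lemma₂ = solve-∀
  lemma₃ : ∀ P R n → P * (R * n + n * R) ≡ R * 2 * (P * n)
  lemma₃ = solve-∀
  lemma₄ : ∀ R E → R * 2 * (2 * E) ≡ R * 4 * E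
  lemma₄ = solve-∀

sat-small : ∀ k q → ∃[ N ] (∀ n → n ≥ N → ∀ s → IsSat n (Q (suc k)) s → s * q < e (Q n))
-- The first summand makes the block directions negligible, the second leaves room for the `K` block
-- coordinates.
sat-small k q = suc (2 * q * K) + K , small
  where
  r K : ℕ
  -- By `n≤2^n` this gives `2 * q * (2 * k) ≤ 2 ^ r`, so the codewords are sparse enough.
  r = 2 * q * (2 * k)
  K = 2 * k * 2 ^ r
  small : ∀ n → n ≥ suc (2 * q * K) + K → ∀ s → IsSat n (Q (suc k)) s → s * q < e (Q n)
  small n n≥N s isSat with m≤n⇒∃[o]m+o≡n (≤-trans (m≤n+m K (suc (2 * q * K))) n≥N)
  ... | n′ , refl = halves (2 ^ r) (2 ^ n) n K (2 * k) q s (e (Q n)) {{m^n≢0 2 r}} {{m^n≢0 2 n}}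
    (sat-bound (hamming-coding k r n′) isSat)
    (2*e-cube n)
    (≤-trans (m≤m+n (suc (2 * q * K)) K) n≥N)
    (n≤2^n r)

theorem1 : (m : ℕ) → m ≥ 1 →
    Σ[ sat ∈ (ℕ → ℕ) ]
    ((∀ n → IsSat n (Q m) (sat n)) × ((λ n → ratio (sat n) (e (Q n))) ⟶ 0ℚ))
theorem1 (suc k) (s≤s z≤n) = sat , sat-isSat , limit
  where
  sat : ℕ → ℕ
  sat n = proj₁ (sat-exists k n)
  sat-isSat : ∀ n → IsSat n (Q (suc k)) (sat n)
  sat-isSat n = proj₂ (sat-exists k n)
  limit : (λ n → ratio (sat n) (e (Q n))) ⟶ 0ℚ
  limit ε 0<ε = proj₁ (sat-small k (↧ₙ ε)) , λ n n≥N →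
    ratio-small (sat n) (e (Q n)) ε 0<ε (proj₂ (sat-small k (↧ₙ ε)) n n≥N (sat n) (sat-isSat n))
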